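{- Let $P^{(k)}$ be a $k$-uniform hyperpath. Let the $k$-uniform hypergraph $\mathcal{H}$ be the coalescence of the hyperpath $P^{(k)}$ at one of its non-cored vertices with a $k$-uniform hypergraph $\mathcal{H}_0$ at its vertex $v_0$. Let the $k$-uniform hypergraph $\mathcal{H}_1$ be obtained by moving $\mathcal{H}_0$ to a cored vertex of $P^{(k)}$, i.e. $\mathcal{H}_1$ is the coalescence of $P^{(k)}$ at one of its cored vertices with $\mathcal{H}_0$ at $v_0$ ($\mathcal{H}_1$ is said to be the first path-sliding transformation of $\mathcal{H}$). Then $\mathcal{H}_1\prec_\alpha\mathcal{H}$ for $k\ge3$ and $0<\alpha<1$.
   Context: Hypergraphs are finite; $k$-uniform means every hyperedge has exactly $k$ vertices. The hyperpath $P_r^{(k)}$ is obtained from the path graph with $r$ edges by inserting $k-2$ new vertices (of degree one) into each edge. A cored vertex is a vertex of degree one; here "cored" and "non-cored" refer to degrees in the hyperpath. The coalescence of two disjoint hypergraphs at vertices $x$ and $y$ is obtained by identifying $x$ with $y$. For a $k$-uniform hypergraph $\mathcal{H}$ on $[n]$, $\mathcal{A}(\mathcal{H})$ is the $k$-order $n$-dimensional tensor with entry $\frac1{(k-1)!}$ at $(i_1,\dots,i_k)$ if $\{i_1,\dots,i_k\}\in E(\mathcal{H})$ and $0$ otherwise; $\mathcal{D}(\mathcal{H})$ is the diagonal tensor of vertex degrees; $\mathcal{A}_\alpha(\mathcal{H})=\alpha\mathcal{D}(\mathcal{H})+(1-\alpha)\mathcal{A}(\mathcal{H})$. For a tensor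 $\mathcal{T}$, $\mathrm{Tr}_d(\mathcal{T})$ is the sum of the $d$-th powers of all $n(k-1)^{n-1}$ eigenvalues of $\mathcal{T}$; in particular $\mathrm{Tr}_0(\mathcal{T})=n(k-1)^{n-1}$, and for $d\ge1$ $$\mathrm{Tr}_{d}(\mathcal{T})=(k-1)^{n-1}\sum_{d_1+\cdots+d_n=d}\ \prod_{i=1}^{n}\frac{1}{(d_i(k-1))!}\Big(\sum_{\gamma\in[n]^{k-1}}(\mathcal{T})_{i\gamma}\frac{\partial}{\partial a_{i\gamma}}\Big)^{d_i}\mathrm{tr}\big(A^{d(k-1)}\big),$$ with $A=(a_{ij})$ an $n\times n$ matrix of indeterminates, $d_i\ge0$ integers, $\frac{\partial}{\partial a_{i\gamma}}=\frac{\partial}{\partial a_{i i_2}}\cdots\frac{\partial}{\partial a_{i i_k}}$ for $\gamma=i_2\cdots i_k$. $S_\alpha$-order: for $k$-uniform hypergraphs $\mathcal{G}_1,\mathcal{G}_2$ with $n$ vertices, $\mathcal{G}_1\prec_\alpha\mathcal{G}_2$ if there is $d\in\{1,\dots,n(k-1)^{n-1}-1\}$ with $\mathrm{Tr}_t(\mathcal{A}_\alpha(\mathcal{G}_1))=\mathrm{Tr}_t(\mathcal{A}_\alpha(\mathcal{G}_2))$ for $t=0,\dots,d-1$ and $\mathrm{Tr}_d(\mathcal{A}_\alpha(\mathcal{G}_1))<\mathrm{Tr}_d(\mathcal{A}_\alpha(\mathcal{G}_2))$.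
   Formalization: The formal theorem additionally assumes that v_0 lies in at least one hyperedge of H_0; if v_0 is isolated in H_0, then H and H_1 are isomorphic, all their traces agree, and the claim fails. -}

module Defs where

open import Level using (Level; _⊔_) renaming (suc to lsuc)
open import Algebra.Apartness.Bundles using (HeytingField; HeytingCommutativeRing)
open import Algebra.Bundles using (CommutativeRing)
import Algebra.Apartness.Properties.HeytingCommutativeRing as HeytingProperties
import Algebra.Definitions.RawMonoid as RawMonoidDefinitions
import Algebra.Properties.Ring as RingProperties
open import Data.Bool using (Bool; true; false; if_then_else_; _∧_; _∨_)
import Data.Bool as Bool
open import Data.Bool.Properties using (∨-zeroʳ)
open import Data.Empty using (⊥-elim)
open import Data.Fin using (Fin; zero; suc; toℕ; inject₁; splitAt; quotient; punchOut; _↑ˡ_; _↑ʳ_)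
import Data.Fin as Fin
open import Data.Fin.Properties using (splitAt-↑ˡ; toℕ-inject₁; inject₁-injective; any?)
open import Data.Fin.Subset using (Subset; ∣_∣; ⁅_⁆; ⋃) renaming (_∈_ to _∈ˢ_)
open import Data.Fin.Subset.Properties using () renaming (_∈?_ to _∈ˢ?_)
open import Data.List using (List; []; _∷_; _++_; map; foldr; concatMap; allFin; upTo; filter; length; deduplicate; cartesianProductWith)
open import Data.List.Membership.Propositional using (_∈_)
import Data.List.Membership.DecPropositional as DecMembership
open import Data.List.Relation.Unary.Unique.Propositional using (Unique)
open import Data.List.Relation.Unary.Unique.Propositional.Properties using (map⁺; allFin⁺)
import Data.List.Relation.Unary.Unique.DecPropositional.Properties as DecUnique
open import Data.Nat using (ℕ; zero; suc; _+_; _*_; _∸_; _^_; _≤_; _<_; _!; NonZero)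
open import Data.Nat.GeneralisedArithmetic using (fold)
open import Data.Nat.Properties using (_!≢0; m≢1+n+m)
open import Data.Product using (_×_; _,_; proj₁; proj₂; ∃-syntax)
open import Data.Sum using (_⊎_; inj₁; inj₂; [_,_]′)
open import Data.Vec using (Vec; []; _∷_; toList; lookup; tabulate; replicate)
open import Data.Vec.Properties using (≡-dec; lookup∘tabulate)
open import Function using (_∘_)
open import Function.Bundles using (_⇔_; Equivalence)
open import Relation.Binary.Core using (Rel)
open import Relation.Binary.Definitions using (DecidableEquality)
open import Relation.Binary.PropositionalEquality using (_≡_; refl; sym; trans; cong)
open import Relation.Binary.Structures using (IsStrictPartialOrder)
open import Relation.Nullary using (yes; no; does)
open import Relation.Nullary.Decidable using (_×-dec_; dec-true)

_≟ˢ_ : ∀ {n} → DecidableEquality (Subset n)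
_≟ˢ_ = ≡-dec Bool._≟_

record Hypergraph (n : ℕ) : Set where
  field
    edges  : List (Subset n)
    unique : Unique edges

open Hypergraph public

Uniform : ∀ {n} → ℕ → Hypergraph n → Set
Uniform k H = ∀ {e} → e ∈ edges H → ∣ e ∣ ≡ k

degree : ∀ {n} → Hypergraph n → Fin n → ℕ
degree H v = length (filter (v ∈ˢ?_) (edges H))

Cored : ∀ {n} → Hypergraph n → Fin n → Set
Cored H v = degree H v ≡ 1

-- The hyperpath with r edges: the first suc r vertices are those of the
-- path graph; the remaining r * (k ∸ 2) vertices come in r consecutive
-- blocks of k ∸ 2, the j-th block being inserted into the path edge
-- {j , j + 1}.

inPathEdge : ∀ k {r} → Fin r → Fin (suc r) ⊎ Fin (r * (k ∸ 2)) → Bool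
inPathEdge k j (inj₁ i) = does (i Fin.≟ inject₁ j) ∨ does (i Fin.≟ suc j)
inPathEdge k j (inj₂ c) = does (quotient (k ∸ 2) c Fin.≟ j)

pathEdge : ∀ k {r} → Fin r → Subset (suc r + r * (k ∸ 2))
pathEdge k {r} j = tabulate (inPathEdge k j ∘ splitAt (suc r))

private
  pathEdge-injective : ∀ k {r} {i j : Fin r} → pathEdge k i ≡ pathEdge k j → i ≡ j
  pathEdge-injective k {r} {i} {j} eq = conclude (ends (inject₁ i) left) (ends (suc i) right)
    where
    at : ∀ (l : Fin r) (v : Fin (suc r)) →
         lookup (pathEdge k l) (v ↑ˡ (r * (k ∸ 2))) ≡ inPathEdge k l (inj₁ v)
    at l v = trans (lookup∘tabulate (inPathEdge k l ∘ splitAt (suc r)) (v ↑ˡ (r * (k ∸ 2))))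
                   (cong (inPathEdge k l) (splitAt-↑ˡ (suc r) v (r * (k ∸ 2))))

    transport : ∀ v → inPathEdge k i (inj₁ v) ≡ true → inPathEdge k j (inj₁ v) ≡ true
    transport v p =
      trans (sym (at j v)) (trans (cong (λ e → lookup e (v ↑ˡ (r * (k ∸ 2)))) (sym eq))
                                  (trans (at i v) p))

    left : inPathEdge k j (inj₁ (inject₁ i)) ≡ true
    left = transport (inject₁ i) (cong (_∨ does (inject₁ i Fin.≟ suc i)) (dec-true (inject₁ i Fin.≟ inject₁ i) refl))

    right : inPathEdge k j (inj₁ (suc i)) ≡ true
    right = transport (suc i) (trans (cong (does (suc i Fin.≟ inject₁ i) ∨_) (dec-true (suc i Fin.≟ suc i) refl))
                             (∨-zeroʳ _))

    ends : ∀ v → inPathEdge k j (inj₁ v) ≡ true → v ≡ inject₁ j ⊎ v ≡ suc j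
    ends v p with v Fin.≟ inject₁ j | v Fin.≟ suc j
    ... | yes q | _     = inj₁ q
    ... | no _  | yes q = inj₂ q
    ends v () | no _  | no _

    conclude : inject₁ i ≡ inject₁ j ⊎ inject₁ i ≡ suc j →
               suc i ≡ inject₁ j ⊎ suc i ≡ suc j → i ≡ j
    conclude (inj₁ p)    _           = inject₁-injective p
    conclude (inj₂ _)    (inj₂ refl) = refl
    conclude (inj₂ p)    (inj₁ q)    = ⊥-elim (m≢1+n+m (toℕ j) {1} (trans
      (trans (sym (toℕ-inject₁ j)) (sym (cong toℕ q)))
      (cong suc (trans (sym (toℕ-inject₁ i)) (cong toℕ p)))))

hyperpath : (k r : ℕ) → Hypergraph (suc r + r * (k ∸ 2))
hyperpath k r = record
  { edges  = map (pathEdge k) (allFin r)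
  ; unique = map⁺ (pathEdge-injective k) (allFin⁺ r)
  }

image : ∀ {m n} → (Fin m → Fin n) → Subset m → Subset n
image f e = tabulate λ v → does (any? λ u → (u ∈ˢ? e) ×-dec (f u Fin.≟ v))

-- In the coalescence of G at x and H at y, the vertices of G come first,
-- y becomes x, and the other n vertices of H follow in their order.
-- Edge sets are united as sets, whence the deduplication.

glue : ∀ {m n} → Fin m → Fin (suc n) → Fin (suc n) → Fin (m + n)
glue {m} {n} x y v with y Fin.≟ v
... | yes _  = x ↑ˡ n
... | no y≢v = m ↑ʳ punchOut y≢v

coalescence : ∀ {m n} → Hypergraph m → Fin m → Hypergraph (suc n) → Fin (suc n) → Hypergraph (m + n)
coalescence {m} {n} G x H y = record
  { edges  = deduplicate _≟ˢ_ united
  ; unique = DecUnique.deduplicate-! _≟ˢ_ united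
  }
  where
  united : List (Subset (m + n))
  united = map (image (_↑ˡ n)) (edges G) ++ map (image (glue x y)) (edges H)

-- The standard library has no real numbers, so the scalars, α included,
-- range over an arbitrary ordered field.  Order is not assumed decidable or total:
-- x and y are apart when one is less than the other.  Both classical
-- ordered fields and constructive reals satisfy these axioms.

record OrderedField (c ℓ₁ ℓ₂ : Level) : Set (lsuc (c ⊔ ℓ₁ ⊔ ℓ₂)) where
  infix 4 _<ᶠ_
  field
    heytingField : HeytingField c ℓ₁ ℓ₂

  open HeytingField heytingField public
    renaming (_+_ to _+ᶠ_; _*_ to _*ᶠ_; _-_ to _-ᶠ_; refl to ≈-refl; sym to ≈-sym; trans to ≈-trans)

  field
    _<ᶠ_                 : Rel Carrier ℓ₂
    isStrictPartialOrder : IsStrictPartialOrder _≈_ _<ᶠ_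
    #⇔<⊎>                : ∀ {x y} → (x # y) ⇔ (x <ᶠ y ⊎ y <ᶠ x)
    +-monoʳ-<            : ∀ x {y z} → y <ᶠ z → (x +ᶠ y) <ᶠ (x +ᶠ z)
    *-pos                : ∀ {x y} → 0# <ᶠ x → 0# <ᶠ y → 0# <ᶠ (x *ᶠ y)

module _ {c ℓ₁ ℓ₂} (F : OrderedField c ℓ₁ ℓ₂) where
  open OrderedField F

  private
    module SPO = IsStrictPartialOrder isStrictPartialOrder
    module HP = HeytingProperties heytingCommutativeRing

  scalarRing : CommutativeRing c ℓ₁
  scalarRing = HeytingCommutativeRing.commutativeRing heytingCommutativeRing

  open RingProperties (CommutativeRing.ring scalarRing) using (-1*x≈-x; -‿involutive)

  0<1 : 0# <ᶠ 1#
  0<1 with Equivalence.to #⇔<⊎> HP.1#0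
  ... | inj₂ p = p
  ... | inj₁ p = ⊥-elim (SPO.irrefl ≈-refl (SPO.trans 0<1′ p))
    where
    0<-1 : 0# <ᶠ (- 1#)
    0<-1 = SPO.<-respʳ-≈ (+-identityʳ (- 1#)) (SPO.<-respˡ-≈ (-‿inverseˡ 1#) (+-monoʳ-< (- 1#) p))
    0<1′ : 0# <ᶠ 1#
    0<1′ = SPO.<-respʳ-≈ (≈-trans (-1*x≈-x (- 1#)) (-‿involutive 1#)) (*-pos 0<-1 0<-1)

  fromℕ : ℕ → Carrier
  fromℕ m = m Mult.× 1#
    where module Mult = RawMonoidDefinitions (CommutativeRing.+-rawMonoid scalarRing)

  fromℕ-pos : ∀ m → 0# <ᶠ fromℕ (suc m)
  fromℕ-pos zero    = SPO.<-respʳ-≈ (≈-sym (+-identityʳ 1#)) 0<1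
  fromℕ-pos (suc m) = SPO.trans 0<1
    (SPO.<-respˡ-≈ (+-identityʳ 1#) (+-monoʳ-< 1# (fromℕ-pos m)))

  fromℕ#0 : ∀ m .{{_ : NonZero m}} → fromℕ m # 0#
  fromℕ#0 (suc m) = Equivalence.from #⇔<⊎> (inj₂ (fromℕ-pos m))

  -- #⇒invertible gives an inverse of fromℕ m - 0#, hence of fromℕ m.
  recip : ∀ m .{{_ : NonZero m}} → Carrier
  recip m = proj₁ (#⇒invertible (fromℕ#0 m))

  recip-inverse : ∀ m .{{_ : NonZero m}} → (recip m *ᶠ fromℕ m) ≈ 1#
  recip-inverse m = ≈-trans (*-congˡ (≈-sym (HP.x-0≈x (fromℕ m))))
                            (proj₁ (proj₂ (#⇒invertible (fromℕ#0 m))))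

  recip! : ℕ → Carrier
  recip! m = recip (m !) {{m !≢0}}

  infixl 6 _⊕_
  infixl 7 _⊗_

  data Poly (n : ℕ) : Set c where
    con     : Carrier → Poly n
    var     : Fin n → Fin n → Poly n
    _⊕_ _⊗_ : Poly n → Poly n → Poly n

  ∂ : ∀ {n} → Fin n → Fin n → Poly n → Poly n
  ∂ i j (con _)   = con 0#
  ∂ i j (var s t) = con (if does (i Fin.≟ s) ∧ does (j Fin.≟ t) then 1# else 0#)
  ∂ i j (p ⊕ q)   = ∂ i j p ⊕ ∂ i j q
  ∂ i j (p ⊗ q)   = ∂ i j p ⊗ q ⊕ p ⊗ ∂ i j q

  constantTerm : ∀ {n} → Poly n → Carrier
  constantTerm (con a)   = a
  constantTerm (var _ _) = 0#
  constantTerm (p ⊕ q)   = constantTerm p +ᶠ constantTerm q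
  constantTerm (p ⊗ q)   = constantTerm p *ᶠ constantTerm q

  Σᴾ : ∀ {a} {A : Set a} {n} → List A → (A → Poly n) → Poly n
  Σᴾ xs f = foldr (λ x p → f x ⊕ p) (con 0#) xs

  powerEntry : ∀ {n} → ℕ → Fin n → Fin n → Poly n
  powerEntry zero    i j = con (if does (i Fin.≟ j) then 1# else 0#)
  powerEntry (suc m) i j = Σᴾ (allFin _) λ l → var i l ⊗ powerEntry m l j

  tracePower : ∀ n → ℕ → Poly n
  tracePower n m = Σᴾ (allFin n) λ i → powerEntry m i i

  -- The entry with index (i , i₂ , … , iₖ) of a tensor T of order k ≥ 1
  -- is T i (i₂ ∷ … ∷ iₖ ∷ []).
  Tensor : ℕ → ℕ → Set c
  Tensor k n = Fin n → Vec (Fin n) (k ∸ 1) → Carrier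

  allIndices : ∀ n m → List (Vec (Fin n) m)
  allIndices n zero    = [] ∷ []
  allIndices n (suc m) = cartesianProductWith _∷_ (allFin n) (allIndices n m)

  -- All (d₁ , … , dₙ) of natural numbers with sum d.
  weakCompositions : ∀ n → ℕ → List (Vec ℕ n)
  weakCompositions zero    zero    = [] ∷ []
  weakCompositions zero    (suc d) = []
  weakCompositions (suc n) d       =
    concatMap (λ a → map (a ∷_) (weakCompositions n (d ∸ a))) (upTo (suc d))

  ∂* : ∀ {n m} → Fin n → Vec (Fin n) m → Poly n → Poly n
  ∂* i []      p = p
  ∂* i (j ∷ γ) p = ∂ i j (∂* i γ p)

  rowOperator : ∀ {k n} → Tensor k n → Fin n → Poly n → Poly n
  rowOperator {k} {n} T i p = Σᴾ (allIndices n (k ∸ 1)) λ γ → con (T i γ) ⊗ ∂* i γ p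

  -- The operator ∏ᵢ 1/(dᵢ(k-1))! (Σ_γ T_{iγ} ∂/∂a_{iγ})^{dᵢ}; its factors
  -- commute.
  traceOperator : ∀ {k n} → Tensor k n → Vec ℕ n → Poly n → Poly n
  traceOperator {k} {n} T ds p =
    foldr (λ i q → con (recip! (lookup ds i * (k ∸ 1))) ⊗ fold q (rowOperator {k} T i) (lookup ds i))
          p (allFin n)

  -- The d-th trace, i.e. the sum of the d-th powers of the n(k-1)ⁿ⁻¹
  -- eigenvalues, through its expression by differential operators.  These
  -- have order d(k-1), the degree of tr A^{d(k-1)}, so the polynomial they
  -- produce is a constant and constantTerm only reads off its value.
  Tr : ∀ {k n} → ℕ → Tensor k n → Carrier
  Tr {k} {n} zero      T = fromℕ (n * (k ∸ 1) ^ (n ∸ 1))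
  Tr {k} {n} d@(suc _) T =
    fromℕ ((k ∸ 1) ^ (n ∸ 1)) *ᶠ
    constantTerm (Σᴾ (weakCompositions n d) λ ds →
      traceOperator {k} T ds (tracePower n (d * (k ∸ 1))))

  indexSet : ∀ {n m} → Vec (Fin n) m → Subset n
  indexSet v = ⋃ (map ⁅_⁆ (toList v))

  adjacencyTensor : ∀ k {n} → Hypergraph n → Tensor k n
  adjacencyTensor k H i γ =
    if does (indexSet (i ∷ γ) ∈? edges H) then recip! (k ∸ 1) else 0#
    where open DecMembership _≟ˢ_ using (_∈?_)

  degreeTensor : ∀ k {n} → Hypergraph n → Tensor k n
  degreeTensor k H i γ =
    if does (≡-dec Fin._≟_ γ (replicate (k ∸ 1) i)) then fromℕ (degree H i) else 0#

  alphaTensor : ∀ k {n} → Carrier → Hypergraph n → Tensor k n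
  alphaTensor k α H i γ =
    α *ᶠ degreeTensor k H i γ +ᶠ (1# -ᶠ α) *ᶠ adjacencyTensor k H i γ

  -- G₁ ≺_α G₂, for k-uniform hypergraphs G₁ and G₂ with n vertices.
  S-order : ∀ k {n} → Carrier → Hypergraph n → Hypergraph n → Set (ℓ₁ ⊔ ℓ₂)
  S-order k {n} α G₁ G₂ =
    ∃[ d ] (1 ≤ d × d ≤ n * (k ∸ 1) ^ (n ∸ 1) ∸ 1 ×
            (∀ t → t < d → trace t G₁ ≈ trace t G₂) ×
            trace d G₁ <ᶠ trace d G₂)
    where
    trace : ℕ → Hypergraph n → Carrier
    trace t G = Tr {k} t (alphaTensor k α G)

{-# OPTIONS --safe #-}

module Submission where

open import Defs
open import Algebra.Bundles using (CommutativeRing)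
import Algebra.Properties.CommutativeSemigroup as CommutativeSemigroupProperties
import Algebra.Properties.Monoid.Sum as MonoidSum
import Algebra.Properties.Semiring.Exp as SemiringExp
import Algebra.Properties.Semiring.Mult as SemiringMult
open import Data.Bool using (true; false; if_then_else_; _∧_; _∨_)
open import Data.Bool.Properties using (∨-zeroʳ)
open import Data.Fin using (Fin; zero; suc; toℕ; inject₁; splitAt; quotient; combine; punchIn; _↑ˡ_; _↑ʳ_)
import Data.Fin as Fin
open import Data.Fin.Properties using
  ( any?; splitAt-↑ˡ; splitAt-↑ʳ; ↑ˡ-injective; ↑ʳ-injective; toℕ-inject₁; remQuot-combine
  ; punchInᵢ≢i; punchOut-cong; punchOut-punchIn; punchOut-injective)
open import Data.Fin.Subset using (Subset; ⁅_⁆; ∣_∣; _⊆_) renaming (_∈_ to _∈ˢ_)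
open import Data.Fin.Subset.Properties
  using (∉⊥; x∈p∪q⁻; x∈⁅y⁆⇒x≡y; ⊆-antisym; ⊆-refl; out⊆; s⊆s; drop-there) renaming (_∈?_ to _∈ˢ?_)
open import Data.List using (List; []; _∷_; _++_; map; foldr; allFin; replicate; length; filter; deduplicate)
import Data.List.Membership.DecPropositional as DecMembership
open import Data.List.Membership.Propositional using (_∈_)
open import Data.List.Membership.Propositional.Properties
  using (∈-allFin; ∈-map⁺; ∈-map⁻; ∈-++⁻; ∈-cartesianProductWith⁺)
open import Data.List.Properties
  using (foldr-map; map-tabulate; filter-++; filter-all; filter-none; filter-some; length-++)
open import Data.List.Relation.Unary.All as All using (All; []; _∷_)
import Data.List.Relation.Unary.All.Properties as All
open import Data.List.Relation.Unary.AllPairs using ([]; _∷_)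
open import Data.List.Relation.Unary.Any as Any using (Any; here; there; _─_)
open import Data.List.Relation.Unary.Unique.Propositional using (Unique)
import Data.List.Relation.Unary.Unique.Propositional.Properties as Unique
open import Data.Nat using (ℕ; zero; suc; _+_; _*_; _∸_; _≤_; _<_; z≤n; s≤s; _!; NonZero; >-nonZero)
  renaming (_^_ to _ℕ^_)
open import Data.Nat.GeneralisedArithmetic using (fold)
open import Data.Nat.Properties using (_!≢0)
import Data.Nat.Properties as ℕ
open import Data.Nat.Tactic.RingSolver using (solve-∀)
open import Data.Product using (∃-syntax; _×_; _,_; proj₁; proj₂)
open import Data.Sum using (_⊎_; inj₁; inj₂)
open import Data.Vec as Vec using (Vec; []; _∷_; lookup; here; there)
open import Data.Vec.Properties
  using (∷-injective; ≡-dec; lookup-replicate; lookup∘tabulate; lookup⇒[]=; []=⇒lookup)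
import Data.Vec.Relation.Unary.All as VecAll
import Data.Vec.Relation.Unary.Any as VecAny
open import Function using (_∘_)
open import Relation.Binary.PropositionalEquality
  using (_≡_; _≢_; refl; sym; trans; cong; cong₂; subst; subst₂)
import Relation.Binary.Reasoning.Setoid as SetoidReasoning
open import Relation.Binary.Structures using (IsStrictPartialOrder)
open import Relation.Nullary using (¬_; yes; no; does; Dec; contradiction)
open import Relation.Nullary.Decidable using (dec-true; dec-false; ¬?; _⊎-dec_; _×-dec_)
open import Relation.Unary using (Decidable)

open MonoidSum ℕ.+-0-monoid using (sum; sum-cong-≗)

-- Differentiating tr A^m along a list of m arcs counts the closed walks that use
-- up these arcs.  When every edge has at least three vertices, the only terms of
-- the first and second trace whose arcs form a closed walk are those all of whose
-- arcs are loops at one vertex.  Hence Tr₁ and Tr₂ of the α-tensor are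
-- α (k-1)^(N-1) Σ deg and α² (k-1)^(N-1) Σ deg².  The sum of degrees of a
-- coalescence does not depend on the vertex x of the path, while the sum of
-- squares depends on it through 2 deg(x) deg(v₀), which is larger at a non-cored
-- vertex.  So d = 2 witnesses the order.

-- Why so few terms survive: the row operator of a vertex `i` creates only arcs that leave `i`. A
-- composition of 1 or 2 involves at most two rows, say of `a` and `b`, so a closed walk through the
-- created arcs never visits a third vertex. An edge with three vertices does not fit into this
-- pair, which leaves loops at `a` together with arcs from `b`, and no closed walk uses both. So
-- vanishing is always a matter of reachability, expressed by a set of vertices that no arc leaves,
-- and Eulerian circuits need not be counted. The one exception is a list of m = d(k-1) loops at a
-- single vertex: it contributes m!, which cancels the factor 1/m! of the trace formula. Polynomials
-- are syntax trees without normal forms. They are therefore compared only through the numbers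
-- obtained by differentiating along every list of arcs and taking the constant term.

Arc : ℕ → Set
Arc n = Fin n × Fin n

-- The accumulator form follows `∂*`, whose outermost derivative belongs to the head of the vector.
-- This makes `E-∂*` hold by mere unfolding.
pushArcs : ∀ {n m} → Fin n → Vec (Fin n) m → List (Arc n) → List (Arc n)
pushArcs i []      L = L
pushArcs i (j ∷ γ) L = pushArcs i γ ((i , j) ∷ L)

module _ {n : ℕ} {p} {P : Arc n → Set p} {i : Fin n} where

  pushArcs-all : ∀ {m} {γ : Vec (Fin n) m} {L} →
                 VecAll.All (λ j → P (i , j)) γ → All P L → All P (pushArcs i γ L)
  pushArcs-all VecAll.[]         all = all
  pushArcs-all (p VecAll.∷ ps) all = pushArcs-all ps (p ∷ all)

  pushArcs-any-old : ∀ {m} (γ : Vec (Fin n) m) {L} → Any P L → Any P (pushArcs i γ L)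
  pushArcs-any-old []      any = any
  pushArcs-any-old (j ∷ γ) any = pushArcs-any-old γ (there any)

  pushArcs-any-new : ∀ {m} {γ : Vec (Fin n) m} {L} →
                     VecAny.Any (λ j → P (i , j)) γ → Any P (pushArcs i γ L)
  pushArcs-any-new {γ = _ ∷ γ} (VecAny.here p)   = pushArcs-any-old γ (here p)
  pushArcs-any-new             (VecAny.there ps) = pushArcs-any-new ps

pushArcs-all-targets : ∀ {n m} (P : Arc n → Set) (i : Fin n) (γ : Vec (Fin n) m) {L} →
                       (∀ j → P (i , j)) → All P L → All P (pushArcs i γ L)
pushArcs-all-targets P i γ p = pushArcs-all (VecAll.universal (λ j → p j) γ)

loops : ∀ {n} → ℕ → Fin n → List (Arc n)
loops m i = replicate m (i , i)

replicate-+-∷ : ∀ {a} {A : Set a} m l {x : A} → replicate (m + suc l) x ≡ replicate (suc (m + l)) x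
replicate-+-∷ zero    l = refl
replicate-+-∷ (suc m) l = cong (_ ∷_) (replicate-+-∷ m l)

pushArcs-loops : ∀ {n} m l (i : Fin n) → pushArcs i (Vec.replicate m i) (loops l i) ≡ loops (m + l) i
pushArcs-loops zero    l i = refl
pushArcs-loops (suc m) l i = trans (pushArcs-loops m (suc l) i) (replicate-+-∷ m l)

-- A walk consumes one arc per step. An arc that obstructs it stays in the list as long as the
-- consumed arc is of another kind.
Any-─⁺ : ∀ {a q} {A : Set a} {Q : A → Set q} {xs : List A} {x} →
         Any Q xs → (x∈xs : x ∈ xs) → ¬ Q x → Any Q (xs ─ x∈xs)
Any-─⁺ (here q)  (here refl)  ¬q = contradiction q ¬q
Any-─⁺ (here q)  (there x∈)   ¬q = here q
Any-─⁺ (there i) (here _)     ¬q = i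
Any-─⁺ (there i) (there x∈)  ¬q = there (Any-─⁺ i x∈ ¬q)

All⇒Any : ∀ {a p} {A : Set a} {P : A → Set p} {m} {γ : Vec A m} → VecAll.All P γ → NonZero m → VecAny.Any P γ
All⇒Any (p VecAll.∷ _) _ = VecAny.here p

¬All⇒Any¬ : ∀ {a p} {A : Set a} {P : A → Set p} {m} → Decidable P → (γ : Vec A m) →
            ¬ VecAll.All P γ → VecAny.Any (¬_ ∘ P) γ
¬All⇒Any¬ P? []      ¬all = contradiction VecAll.[] ¬all
¬All⇒Any¬ P? (j ∷ γ) ¬all with P? j
... | yes p = VecAny.there (¬All⇒Any¬ P? γ (¬all ∘ (p VecAll.∷_)))
... | no ¬p = VecAny.here ¬p

all-replicate : ∀ {a} {A : Set a} m (x : A) → VecAll.All (_≡ x) (Vec.replicate m x)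
all-replicate zero    x = VecAll.[]
all-replicate (suc m) x = refl VecAll.∷ all-replicate m x

≢replicate⇒Any≢ : ∀ {m n} {i : Fin n} (γ : Vec (Fin n) m) → γ ≢ Vec.replicate m i → VecAny.Any (_≢ i) γ
≢replicate⇒Any≢ []      γ≢ = contradiction refl γ≢
≢replicate⇒Any≢ {i = i} (j ∷ γ) γ≢ with j Fin.≟ i
... | yes refl = VecAny.there (≢replicate⇒Any≢ γ (γ≢ ∘ cong (j ∷_)))
... | no j≢i   = VecAny.here j≢i

-- Compositions of 1 and 2, and edges with three vertices

single : ∀ {n} → Fin n → ℕ → Vec ℕ n
single zero    d = d ∷ Vec.replicate _ 0
single (suc i) d = 0 ∷ single i d

lookup-single : ∀ {n} (i : Fin n) d → lookup (single i d) i ≡ d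
lookup-single zero    d = refl
lookup-single (suc i) d = lookup-single i d

lookup-single-≢ : ∀ {n} (i : Fin n) d j → j ≢ i → lookup (single i d) j ≡ 0
lookup-single-≢ zero    d zero    j≢i = contradiction refl j≢i
lookup-single-≢ zero    d (suc j) j≢i = lookup-replicate j 0
lookup-single-≢ (suc i) d zero    j≢i = refl
lookup-single-≢ (suc i) d (suc j) j≢i = lookup-single-≢ i d j (j≢i ∘ cong suc)

-- Compositions of 2 are of the form `single i 2` or have one unit at each of two distinct vertices;
-- this is the second kind.
Mixed : ∀ {n} → Vec ℕ n → Fin n → Fin n → Set
Mixed ds a b = a ≢ b × lookup ds a ≡ 1 × lookup ds b ≡ 1 × (∀ j → j ≢ a → j ≢ b → lookup ds j ≡ 0)

-- What uniformity with k ≥ 3 is used for. Explicit witnesses pass through injective images without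
-- any computation of cardinalities.
ThreeVertices : ∀ {n} → Subset n → Set
ThreeVertices e = ∃[ p ] ∃[ q ] ∃[ r ] (p ∈ˢ e × q ∈ˢ e × r ∈ˢ e × p ≢ q × p ≢ r × q ≢ r)

threeVertices-avoid : ∀ {n} {e : Subset n} → ThreeVertices e → ∀ a b → ∃[ v ] (v ∈ˢ e × v ≢ a × v ≢ b)
threeVertices-avoid (p , q , r , p∈ , q∈ , r∈ , p≢q , p≢r , q≢r) a b with p Fin.≟ a | p Fin.≟ b
... | no p≢a   | no p≢b = p , p∈ , p≢a , p≢b
... | yes refl | _ with q Fin.≟ b
...   | no q≢b   = q , q∈ , p≢q ∘ sym , q≢b
...   | yes refl = r , r∈ , p≢r ∘ sym , q≢r ∘ sym
threeVertices-avoid (p , q , r , p∈ , q∈ , r∈ , p≢q , p≢r , q≢r) a b | no _ | yes refl with q Fin.≟ a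
...   | no q≢a   = q , q∈ , q≢a , p≢q ∘ sym
...   | yes refl = r , r∈ , q≢r ∘ sym , p≢r ∘ sym

module _ {c ℓ₁ ℓ₂} (F : OrderedField c ℓ₁ ℓ₂) where
  open OrderedField F using
    ( Carrier; _≈_; _+ᶠ_; _*ᶠ_; 0#; 1#; _<ᶠ_; +-monoʳ-<; *-pos; ≈-refl; ≈-sym; ≈-trans
    ; +-cong; +-congˡ; +-congʳ; *-cong; *-congˡ; *-congʳ; isStrictPartialOrder)
  private
    module R = CommutativeRing (scalarRing F)
  open SetoidReasoning R.setoid
  open SemiringExp R.semiring using (_^_)

  -- Finite sums of scalars

  Σᶠ : ∀ {a} {A : Set a} → List A → (A → Carrier) → Carrier
  Σᶠ xs f = foldr (λ x s → f x +ᶠ s) 0# xs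

  Σᶠ-cong : ∀ {a} {A : Set a} (xs : List A) {f g : A → Carrier} → (∀ x → f x ≈ g x) → Σᶠ xs f ≈ Σᶠ xs g
  Σᶠ-cong []       f≈g = ≈-refl
  Σᶠ-cong (x ∷ xs) f≈g = +-cong (f≈g x) (Σᶠ-cong xs f≈g)

  Σᶠ-zero : ∀ {a} {A : Set a} {xs : List A} {f : A → Carrier} → All (λ x → f x ≈ 0#) xs → Σᶠ xs f ≈ 0#
  Σᶠ-zero []         = ≈-refl
  Σᶠ-zero (fx ∷ fxs) = ≈-trans (+-cong fx (Σᶠ-zero fxs)) (R.+-identityˡ 0#)

  Σᶠ-single : ∀ {a} {A : Set a} {xs : List A} {x} (f : A → Carrier) → Unique xs → x ∈ xs →
              (∀ y → y ≢ x → f y ≈ 0#) → Σᶠ xs f ≈ f x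
  Σᶠ-single f (x≢ ∷ _) (here refl) f≈0 =
    ≈-trans (+-congˡ (Σᶠ-zero (All.map (λ x≢y → f≈0 _ (x≢y ∘ sym)) x≢))) (R.+-identityʳ _)
  Σᶠ-single f (x≢ ∷ uniq) (there x∈) f≈0 =
    ≈-trans (+-cong (f≈0 _ (All.lookup x≢ x∈)) (Σᶠ-single f uniq x∈ f≈0)) (R.+-identityˡ _)

  Σᶠ-++ : ∀ {a} {A : Set a} (xs ys : List A) (f : A → Carrier) → Σᶠ (xs ++ ys) f ≈ Σᶠ xs f +ᶠ Σᶠ ys f
  Σᶠ-++ []       ys f = ≈-sym (R.+-identityˡ _)
  Σᶠ-++ (x ∷ xs) ys f = ≈-trans (+-congˡ (Σᶠ-++ xs ys f)) (≈-sym (R.+-assoc _ _ _))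

  Σᶠ-map : ∀ {a b} {A : Set a} {B : Set b} (g : A → B) xs (f : B → Carrier) → Σᶠ (map g xs) f ≡ Σᶠ xs (f ∘ g)
  Σᶠ-map g xs f = foldr-map _ g 0# xs

  Σᶠ-distribˡ : ∀ {a} {A : Set a} y (xs : List A) (f : A → Carrier) → Σᶠ xs (λ x → y *ᶠ f x) ≈ y *ᶠ Σᶠ xs f
  Σᶠ-distribˡ y []       f = ≈-sym (R.zeroʳ y)
  Σᶠ-distribˡ y (x ∷ xs) f = ≈-trans (+-congˡ (Σᶠ-distribˡ y xs f)) (≈-sym (R.distribˡ _ _ _))

  Σᶠ-allFin-suc : ∀ n (f : Fin (suc n) → Carrier) → Σᶠ (allFin (suc n)) f ≡ f zero +ᶠ Σᶠ (allFin n) (f ∘ suc)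
  Σᶠ-allFin-suc n f = cong (f zero +ᶠ_) (trans (cong (λ xs → Σᶠ xs f) (sym (map-tabulate (λ i → i) suc))) (Σᶠ-map suc (allFin n) f))

  private
    0*x+y : ∀ x y → 0# *ᶠ x +ᶠ y ≈ y
    0*x+y x y = ≈-trans (+-congʳ (R.zeroˡ x)) (R.+-identityˡ y)

  -- Iterated differentiation

  -- This is the coefficient in `p` of the monomial of the arcs of `L`, times the factorials of
  -- their multiplicities.
  E : ∀ {n} → List (Arc n) → Poly F n → Carrier
  E []            p = constantTerm F p
  E ((i , j) ∷ L) p = E L (∂ F i j p)

  E-⊕ : ∀ {n} (L : List (Arc n)) p q → E L (p ⊕ q) ≡ E L p +ᶠ E L q
  E-⊕ []      p q = refl
  E-⊕ (_ ∷ L) p q = E-⊕ L _ _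

  E-con0 : ∀ {n} (L : List (Arc n)) → E L (con 0#) ≡ 0#
  E-con0 []      = refl
  E-con0 (_ ∷ L) = E-con0 L

  E-scale : ∀ {n} (L : List (Arc n)) a p → E L (con a ⊗ p) ≈ a *ᶠ E L p
  E-scale []            a p = ≈-refl
  E-scale ((i , j) ∷ L) a p = begin
    E L (con 0# ⊗ p ⊕ con a ⊗ ∂ F i j p)            ≡⟨ E-⊕ L _ _ ⟩
    -- The derivative of the constant leaves a syntactic summand `con 0# ⊗ p`, which the induction
    -- hypothesis at the scalar 0 removes.
    E L (con 0# ⊗ p) +ᶠ E L (con a ⊗ ∂ F i j p)     ≈⟨ +-cong (E-scale L 0# p) (E-scale L a _) ⟩
    0# *ᶠ E L p +ᶠ a *ᶠ E L (∂ F i j p)             ≈⟨ 0*x+y _ _ ⟩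
    a *ᶠ E L (∂ F i j p)                            ∎

  E-Σ : ∀ {a} {A : Set a} {n} (L : List (Arc n)) (xs : List A) f → E L (Σᴾ F xs f) ≡ Σᶠ xs (λ x → E L (f x))
  E-Σ L []       f = E-con0 L
  E-Σ L (x ∷ xs) f = trans (E-⊕ L _ _) (cong (E L (f x) +ᶠ_) (E-Σ L xs f))

  E-∂* : ∀ {n m} (L : List (Arc n)) i (γ : Vec (Fin n) m) p → E L (∂* F i γ p) ≡ E (pushArcs i γ L) p
  E-∂* L i []      p = refl
  E-∂* L i (j ∷ γ) p = E-∂* ((i , j) ∷ L) i γ p

  E-row : ∀ {k n} (L : List (Arc n)) (T : Tensor F k n) i p →
          E L (rowOperator F {k} T i p) ≈ Σᶠ (allIndices F n (k ∸ 1)) (λ γ → T i γ *ᶠ E (pushArcs i γ L) p)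
  E-row {k} {n} L T i p = ≈-trans (R.reflexive (E-Σ L (allIndices F n (k ∸ 1)) _)) (Σᶠ-cong (allIndices F n (k ∸ 1)) λ γ →
    ≈-trans (E-scale L (T i γ) _) (*-congˡ (R.reflexive (E-∂* L i γ p))))

  E-con-nonempty : ∀ {n p} {P : Arc n → Set p} {L} a → Any P L → E L (con a) ≈ 0#
  E-con-nonempty {L = _ ∷ L} a _ = R.reflexive (E-con0 L)

  -- By the Leibniz rule, differentiating a_{il} q hits the variable once and q otherwise.
  E-var-zero : ∀ {n} (L : List (Arc n)) i l q → (∀ (p : (i , l) ∈ L) → E (L ─ p) q ≈ 0#) → E L (var i l ⊗ q) ≈ 0#
  E-var-zero []            i l q rest = R.zeroˡ _
  E-var-zero ((s , t) ∷ L) i l q rest = begin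
    E L (con δ ⊗ q ⊕ var i l ⊗ ∂ F s t q)          ≡⟨ E-⊕ L _ _ ⟩
    E L (con δ ⊗ q) +ᶠ E L (var i l ⊗ ∂ F s t q)   ≈⟨ +-cong (E-scale L δ q) (E-var-zero L i l _ (λ p → rest (there p))) ⟩
    δ *ᶠ E L q +ᶠ 0#                               ≈⟨ R.+-identityʳ _ ⟩
    δ *ᶠ E L q                                     ≈⟨ δE≈0 ⟩
    0#                                             ∎
    where
    δ : Carrier
    δ = if does (s Fin.≟ i) ∧ does (t Fin.≟ l) then 1# else 0#
    δE≈0 : δ *ᶠ E L q ≈ 0#
    δE≈0 with s Fin.≟ i | t Fin.≟ l
    ... | yes refl | yes refl = ≈-trans (*-congˡ (rest (here refl))) (R.zeroʳ _)
    ... | yes _    | no _     = R.zeroˡ _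
    ... | no _     | _        = R.zeroˡ _

  -- Decomposition by the first step: a walk from `i` has to begin with some arc `(i , l)` of `L`,
  -- and the rest of it uses up the remaining arcs.
  E-power-zero : ∀ {n} (L : List (Arc n)) m i j →
                 (∀ l (p : (i , l) ∈ L) → E (L ─ p) (powerEntry F m l j) ≈ 0#) → E L (powerEntry F (suc m) i j) ≈ 0#
  E-power-zero {n} L m i j rest = ≈-trans (R.reflexive (E-Σ L (allFin n) _))
    (Σᶠ-zero (All.universal (λ l → E-var-zero L i l _ (rest l)) (allFin n)))

  -- E L (powerEntry m x y) counts the walks from x to y that use up the arcs L.
  -- A walk that enters a closed set C cannot leave it.
  module ClosedSet {n : ℕ} (C : Fin n → Set) (C? : Decidable C) where

    Closed : List (Arc n) → Set
    Closed = All (λ a → C (proj₁ a) → C (proj₂ a))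

    -- A walk that starts in `C` stays there, so the arc that starts outside is never consumed. It
    -- is still there when the walk has length 0, and then differentiates a constant.
    trapped-zero : ∀ m {L x y} → Closed L → Any (λ a → ¬ C (proj₁ a)) L → C x → E L (powerEntry F m x y) ≈ 0#
    trapped-zero zero    cl out cx = E-con-nonempty _ out
    trapped-zero (suc m) {L} {x} {y} cl out cx = E-power-zero L m x y λ l p →
      trapped-zero m (All.─⁺ p cl) (Any-─⁺ out p (λ ¬cx → ¬cx cx)) (All.lookup cl p cx)

    -- The walk stays in `C`, so at length 0 its position differs from `y` and the entry of the
    -- identity matrix is 0.
    escape-zero : ∀ m {L x y} → Closed L → C x → ¬ C y → E L (powerEntry F m x y) ≈ 0#
    escape-zero zero    {L} {x} {y} cl cx ¬cy with x Fin.≟ y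
    ... | yes refl = contradiction cx ¬cy
    ... | no _     = R.reflexive (E-con0 L)
    escape-zero (suc m) {L} {x} {y} cl cx ¬cy = E-power-zero L m x y λ l p →
      escape-zero m (All.─⁺ p cl) (All.lookup cl p cx) ¬cy

    -- The arc into `C` has to be used at some time. From then on the walk is in `C` and cannot get
    -- back to `y`.
    outside-zero : ∀ m {L x y} → Closed L → Any (λ a → C (proj₂ a)) L → ¬ C x → ¬ C y → E L (powerEntry F m x y) ≈ 0#
    outside-zero zero    cl into ¬cx ¬cy = E-con-nonempty _ into
    outside-zero (suc m) {L} {x} {y} cl into ¬cx ¬cy = E-power-zero L m x y step
      where
      step : ∀ l (p : (x , l) ∈ L) → E (L ─ p) (powerEntry F m l y) ≈ 0#
      step l p with C? l
      ... | yes cl′ = escape-zero m (All.─⁺ p cl) cl′ ¬cy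
      ... | no ¬cl  = outside-zero m (All.─⁺ p cl) (Any-─⁺ into p ¬cl) ¬cl ¬cy

    -- A closed walk based in `C` misses the arc that starts outside; one based outside cannot
    -- return after the arc into `C`.
    trace-zero : ∀ m {L} → Closed L → Any (λ a → C (proj₂ a)) L → Any (λ a → ¬ C (proj₁ a)) L →
                 E L (tracePower F n m) ≈ 0#
    trace-zero m {L} cl into out = ≈-trans (R.reflexive (E-Σ L (allFin n) _)) (Σᶠ-zero (All.universal diagonal (allFin n)))
      where
      diagonal : ∀ x → E L (powerEntry F m x x) ≈ 0#
      diagonal x with C? x
      ... | yes cx = trapped-zero m cl out cx
      ... | no ¬cx = outside-zero m cl into ¬cx ¬cx

  -- Loops at a single vertex

  -- Any of the `suc m` derivatives can be the one that hits the variable, and each choice leaves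
  -- `m` for `q`. The induction is over all `q`: passing to `∂ F i i q` moves one loop from the list
  -- into the polynomial.
  E-loops-var : ∀ {n} m (i : Fin n) q → E (loops (suc m) i) (var i i ⊗ q) ≈ fromℕ F (suc m) *ᶠ E (loops m i) q
  E-loops-var m i q = begin
    E (loops m i) (con δ ⊗ q ⊕ var i i ⊗ ∂ F i i q)            ≡⟨ E-⊕ (loops m i) _ _ ⟩
    E (loops m i) (con δ ⊗ q) +ᶠ E (loops m i) (var i i ⊗ ∂ F i i q)
      ≈⟨ +-cong (≈-trans (E-scale (loops m i) δ q) (*-congʳ (R.reflexive δ≡1))) (rest m) ⟩
    1# *ᶠ E (loops m i) q +ᶠ fromℕ F m *ᶠ E (loops m i) q      ≈⟨ R.distribʳ _ _ _ ⟨
    fromℕ F (suc m) *ᶠ E (loops m i) q                         ∎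
    where
    δ : Carrier
    δ = if does (i Fin.≟ i) ∧ does (i Fin.≟ i) then 1# else 0#
    δ≡1 : δ ≡ 1#
    δ≡1 rewrite dec-true (i Fin.≟ i) refl = refl
    rest : ∀ m → E (loops m i) (var i i ⊗ ∂ F i i q) ≈ fromℕ F m *ᶠ E (loops m i) q
    rest zero     = ≈-trans (R.zeroˡ _) (≈-sym (R.zeroˡ _))
    rest (suc m′) = E-loops-var m′ i (∂ F i i q)

  fromℕ-* : ∀ a b → fromℕ F (a * b) ≈ fromℕ F a *ᶠ fromℕ F b
  fromℕ-* = SemiringMult.×1-homo-* R.semiring

  fromℕ-+ : ∀ a b → fromℕ F (a + b) ≈ fromℕ F a +ᶠ fromℕ F b
  fromℕ-+ = SemiringMult.×-homo-+ R.semiring 1#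

  E-loops-power : ∀ {n} m (i : Fin n) → E (loops m i) (powerEntry F m i i) ≈ fromℕ F (m !)
  E-loops-power     zero    i rewrite dec-true (i Fin.≟ i) refl = ≈-sym (R.+-identityʳ 1#)
  E-loops-power {n} (suc m) i = begin
    E (loops (suc m) i) (powerEntry F (suc m) i i)
      ≡⟨ E-Σ (loops (suc m) i) (allFin n) _ ⟩
    Σᶠ (allFin n) (λ l → E (loops (suc m) i) (var i l ⊗ powerEntry F m l i))
      ≈⟨ Σᶠ-single _ (Unique.allFin⁺ n) (∈-allFin i) (λ l l≢i → E-var-zero (loops (suc m) i) i l _ λ p →
           contradiction (cong proj₂ (All.lookup (All.replicate⁺ {P = _≡ (i , i)} (suc m) refl) p)) l≢i) ⟩
    E (loops (suc m) i) (var i i ⊗ powerEntry F m i i)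
      ≈⟨ E-loops-var m i _ ⟩
    fromℕ F (suc m) *ᶠ E (loops m i) (powerEntry F m i i)
      ≈⟨ *-congˡ (E-loops-power m i) ⟩
    fromℕ F (suc m) *ᶠ fromℕ F (m !)
      ≈⟨ fromℕ-* (suc m) (m !) ⟨
    fromℕ F (suc m !) ∎

  E-loops-trace : ∀ {n} m .{{_ : NonZero m}} (i : Fin n) → E (loops m i) (tracePower F n m) ≈ fromℕ F (m !)
  E-loops-trace {n} m@(suc m′) i = begin
    E (loops m i) (tracePower F n m)
      ≡⟨ E-Σ (loops m i) (allFin n) _ ⟩
    Σᶠ (allFin n) (λ x → E (loops m i) (powerEntry F m x x))
      -- A closed walk based at `x ≢ i` would have to reach `i` to use a loop, and could not leave
      -- again. This needs at least one loop, hence `m` nonzero: the trace of the zeroth power is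
      -- `n` and not 0!.
      ≈⟨ Σᶠ-single _ (Unique.allFin⁺ n) (∈-allFin i) (λ x x≢i →
           outside-zero m (All.replicate⁺ m (λ ii → ii)) (here refl) x≢i x≢i) ⟩
    E (loops m i) (powerEntry F m i i)
      ≈⟨ E-loops-power m i ⟩
    fromℕ F (m !) ∎
    where open ClosedSet (_≡ i) (Fin._≟ i)

  allIndices-unique : ∀ n m → Unique (allIndices F n m)
  allIndices-unique n zero    = [] ∷ []
  allIndices-unique n (suc m) = Unique.cartesianProductWith⁺ _∷_ ∷-injective (Unique.allFin⁺ n) (allIndices-unique n m)

  ∈-allIndices : ∀ {n m} (γ : Vec (Fin n) m) → γ ∈ allIndices F n m
  ∈-allIndices []      = here refl
  ∈-allIndices (j ∷ γ) = ∈-cartesianProductWith⁺ _∷_ (∈-allFin j) (∈-allIndices γ)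

  -- Traces

  Σᶠ-weakCompositions-0 : ∀ n (f : Vec ℕ n → Carrier) → Σᶠ (weakCompositions F n 0) f ≈ f (Vec.replicate n 0)
  Σᶠ-weakCompositions-0 zero    f = R.+-identityʳ _
  Σᶠ-weakCompositions-0 (suc n) f = begin
    Σᶠ (map (0 ∷_) (weakCompositions F n 0) ++ []) f     ≈⟨ Σᶠ-++ (map (0 ∷_) (weakCompositions F n 0)) [] f ⟩
    Σᶠ (map (0 ∷_) (weakCompositions F n 0)) f +ᶠ 0#     ≈⟨ R.+-identityʳ _ ⟩
    Σᶠ (map (0 ∷_) (weakCompositions F n 0)) f           ≡⟨ Σᶠ-map (0 ∷_) (weakCompositions F n 0) f ⟩
    Σᶠ (weakCompositions F n 0) (f ∘ (0 ∷_))             ≈⟨ Σᶠ-weakCompositions-0 n (f ∘ (0 ∷_)) ⟩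
    f (Vec.replicate (suc n) 0)                          ∎

  Σᶠ-weakCompositions-1 : ∀ n (f : Vec ℕ n → Carrier) → Σᶠ (weakCompositions F n 1) f ≈ Σᶠ (allFin n) (λ i → f (single i 1))
  Σᶠ-weakCompositions-1 zero    f = ≈-refl
  Σᶠ-weakCompositions-1 (suc n) f = begin
    Σᶠ (map (0 ∷_) W₁ ++ map (1 ∷_) W₀ ++ []) f
      ≈⟨ ≈-trans (Σᶠ-++ (map (0 ∷_) W₁) _ f) (+-congˡ (Σᶠ-++ (map (1 ∷_) W₀) [] f)) ⟩
    Σᶠ (map (0 ∷_) W₁) f +ᶠ (Σᶠ (map (1 ∷_) W₀) f +ᶠ 0#)
      ≈⟨ +-cong
           (≈-trans (R.reflexive (Σᶠ-map (0 ∷_) W₁ f)) (Σᶠ-weakCompositions-1 n _))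
           (≈-trans (R.+-identityʳ _) (≈-trans (R.reflexive (Σᶠ-map (1 ∷_) W₀ f)) (Σᶠ-weakCompositions-0 n _))) ⟩
    Σᶠ (allFin n) (λ i → f (single (suc i) 1)) +ᶠ f (single zero 1)
      ≈⟨ R.+-comm _ _ ⟩
    f (single zero 1) +ᶠ Σᶠ (allFin n) (λ i → f (single (suc i) 1))
      ≡⟨ Σᶠ-allFin-suc n (λ i → f (single i 1)) ⟨
    Σᶠ (allFin (suc n)) (λ i → f (single i 1)) ∎
    where
    W₀ W₁ : List (Vec ℕ n)
    W₀ = weakCompositions F n 0
    W₁ = weakCompositions F n 1

  -- Split by the first entry. With entry 1 the remaining unit lies elsewhere, so the whole middle
  -- block is mixed; entry 0 is the induction and entry 2 gives `single zero 2`.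
  Σᶠ-weakCompositions-2 : ∀ n (f : Vec ℕ n → Carrier) → (∀ ds a b → Mixed ds a b → f ds ≈ 0#) →
                          Σᶠ (weakCompositions F n 2) f ≈ Σᶠ (allFin n) (λ i → f (single i 2))
  Σᶠ-weakCompositions-2 zero    f mixed = ≈-refl
  Σᶠ-weakCompositions-2 (suc n) f mixed = begin
    Σᶠ (map (0 ∷_) W₂ ++ map (1 ∷_) W₁ ++ map (2 ∷_) W₀ ++ []) f
      ≈⟨ ≈-trans (Σᶠ-++ (map (0 ∷_) W₂) _ f) (+-congˡ (≈-trans (Σᶠ-++ (map (1 ∷_) W₁) _ f) (+-congˡ (Σᶠ-++ (map (2 ∷_) W₀) [] f)))) ⟩
    Σᶠ (map (0 ∷_) W₂) f +ᶠ (Σᶠ (map (1 ∷_) W₁) f +ᶠ (Σᶠ (map (2 ∷_) W₀) f +ᶠ 0#))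
      ≈⟨ +-cong
           (≈-trans (R.reflexive (Σᶠ-map (0 ∷_) W₂ f)) (Σᶠ-weakCompositions-2 n _ mixed-0))
           (+-cong (≈-trans (R.reflexive (Σᶠ-map (1 ∷_) W₁ f)) (≈-trans (Σᶠ-weakCompositions-1 n _) (Σᶠ-zero (All.universal mixed-1 (allFin n)))))
             (≈-trans (R.+-identityʳ _) (≈-trans (R.reflexive (Σᶠ-map (2 ∷_) W₀ f)) (Σᶠ-weakCompositions-0 n _)))) ⟩
    Σᶠ (allFin n) (λ i → f (single (suc i) 2)) +ᶠ (0# +ᶠ f (single zero 2))
      ≈⟨ ≈-trans (+-congˡ (R.+-identityˡ _)) (R.+-comm _ _) ⟩
    f (single zero 2) +ᶠ Σᶠ (allFin n) (λ i → f (single (suc i) 2))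
      ≡⟨ Σᶠ-allFin-suc n (λ i → f (single i 2)) ⟨
    Σᶠ (allFin (suc n)) (λ i → f (single i 2)) ∎
    where
    W₀ W₁ W₂ : List (Vec ℕ n)
    W₀ = weakCompositions F n 0
    W₁ = weakCompositions F n 1
    W₂ = weakCompositions F n 2

    mixed-0 : ∀ ds a b → Mixed ds a b → f (0 ∷ ds) ≈ 0#
    mixed-0 ds a b (a≢b , dsa , dsb , others) = mixed (0 ∷ ds) (suc a) (suc b)
      ((λ { refl → a≢b refl }) , dsa , dsb ,
       λ { zero _ _ → refl ; (suc j) j≢a j≢b → others j (j≢a ∘ cong suc) (j≢b ∘ cong suc) })

    mixed-1 : ∀ i → f (1 ∷ single i 1) ≈ 0#
    mixed-1 i = mixed (1 ∷ single i 1) zero (suc i)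
      ((λ ()) , refl , lookup-single i 1 ,
       λ { zero 0≢0 _ → contradiction refl 0≢0 ; (suc j) _ j≢i → lookup-single-≢ i 1 j (j≢i ∘ cong suc) })

  -- Row operators and the trace operator

  infix 4 _≃_
  -- Equality of all Taylor coefficients at 0, which stands in for equality of polynomials.
  _≃_ : ∀ {n} → Poly F n → Poly F n → Set ℓ₁
  p ≃ q = ∀ L → E L p ≈ E L q

  module _ {k n : ℕ} (T : Tensor F k n) where

    private
      K : ℕ
      K = k ∸ 1
      row : Fin n → Poly F n → Poly F n
      row = rowOperator F {k} T
      diag : Fin n → Carrier
      diag i = T i (Vec.replicate K i)

    row-cong : ∀ i {p q} → p ≃ q → row i p ≃ row i q
    row-cong i {p} {q} p≃q L = begin
      E L (row i p)                                                ≈⟨ E-row {k} L T i p ⟩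
      Σᶠ (allIndices F n K) (λ γ → T i γ *ᶠ E (pushArcs i γ L) p)  ≈⟨ Σᶠ-cong (allIndices F n K) (λ γ → *-congˡ (p≃q (pushArcs i γ L))) ⟩
      Σᶠ (allIndices F n K) (λ γ → T i γ *ᶠ E (pushArcs i γ L) q)  ≈⟨ E-row {k} L T i q ⟨
      E L (row i q)                                                ∎

    -- Carries the reciprocal factorial of an inner row operator past an outer one.
    row-scale : ∀ i x p L → E L (row i (con x ⊗ p)) ≈ x *ᶠ E L (row i p)
    row-scale i x p L = begin
      E L (row i (con x ⊗ p))
        ≈⟨ E-row {k} L T i (con x ⊗ p) ⟩
      Σᶠ (allIndices F n K) (λ γ → T i γ *ᶠ E (pushArcs i γ L) (con x ⊗ p))
        ≈⟨ Σᶠ-cong (allIndices F n K) (λ γ → ≈-trans (*-congˡ (E-scale (pushArcs i γ L) x p)) (x*yz≈y*xz _ _ _)) ⟩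
      Σᶠ (allIndices F n K) (λ γ → x *ᶠ (T i γ *ᶠ E (pushArcs i γ L) p))
        ≈⟨ Σᶠ-distribˡ x (allIndices F n K) _ ⟩
      x *ᶠ Σᶠ (allIndices F n K) (λ γ → T i γ *ᶠ E (pushArcs i γ L) p)
        ≈⟨ *-congˡ (E-row {k} L T i p) ⟨
      x *ᶠ E L (row i p) ∎
      where open CommutativeSemigroupProperties R.*-commutativeSemigroup using () renaming (x∙yz≈y∙xz to x*yz≈y*xz)

    fold-row-cong : ∀ i d {p q} → p ≃ q → fold p (row i) d ≃ fold q (row i) d
    fold-row-cong i zero    p≃q = p≃q
    fold-row-cong i (suc d) p≃q = row-cong i (fold-row-cong i d p≃q)

    row-zero : ∀ L i p → (∀ γ → E (pushArcs i γ L) p ≈ 0# ⊎ T i γ ≈ 0#) → E L (row i p) ≈ 0#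
    row-zero L i p vanish = ≈-trans (E-row {k} L T i p) (Σᶠ-zero (All.universal term (allIndices F n K)))
      where
      term : ∀ γ → T i γ *ᶠ E (pushArcs i γ L) p ≈ 0#
      term γ with vanish γ
      ... | inj₁ E≈0 = ≈-trans (*-congˡ E≈0) (R.zeroʳ _)
      ... | inj₂ T≈0 = ≈-trans (*-congʳ T≈0) (R.zeroˡ _)

    module _ (i : Fin n) (p : Poly F n)
             (vanish : ∀ {L} → All (λ a → proj₁ a ≡ i) L → Any (λ a → proj₂ a ≢ i) L → E L p ≈ 0#) where

      -- Further applications of `row i` only add arcs from `i`, so both conditions on the list
      -- persist until `vanish` applies.
      fold-row-zero : ∀ d {L} → All (λ a → proj₁ a ≡ i) L → Any (λ a → proj₂ a ≢ i) L → E L (fold p (row i) d) ≈ 0#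
      fold-row-zero zero    from-i leaves = vanish from-i leaves
      fold-row-zero (suc d) from-i leaves = row-zero _ i _ λ γ → inj₁
        (fold-row-zero d (pushArcs-all-targets (λ a → proj₁ a ≡ i) i γ (λ _ → refl) from-i) (pushArcs-any-old γ leaves))

      -- In each application, any index other than `(i, …, i)` creates an arc from `i` to another
      -- vertex and so contributes 0. The number `l` of loops already present is kept general for
      -- the induction.
      E-fold-row : ∀ d l → E (loops l i) (fold p (row i) d) ≈ diag i ^ d *ᶠ E (loops (d * K + l) i) p
      E-fold-row zero    l = ≈-sym (R.*-identityˡ _)
      E-fold-row (suc d) l = begin
        E (loops l i) (row i q)
          ≈⟨ E-row {k} (loops l i) T i q ⟩
        Σᶠ (allIndices F n K) (λ γ → T i γ *ᶠ E (pushArcs i γ (loops l i)) q)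
          ≈⟨ Σᶠ-single _ (allIndices-unique n K) (∈-allIndices _) (λ γ γ≢ → ≈-trans (*-congˡ (fold-row-zero d
               (pushArcs-all-targets (λ a → proj₁ a ≡ i) i γ (λ _ → refl) (All.replicate⁺ l refl))
               (pushArcs-any-new (≢replicate⇒Any≢ γ γ≢)))) (R.zeroʳ _)) ⟩
        diag i *ᶠ E (pushArcs i (Vec.replicate K i) (loops l i)) q
          ≡⟨ cong (λ L → diag i *ᶠ E L q) (pushArcs-loops K l i) ⟩
        diag i *ᶠ E (loops (K + l) i) q
          ≈⟨ *-congˡ (E-fold-row d (K + l)) ⟩
        diag i *ᶠ (diag i ^ d *ᶠ E (loops (d * K + (K + l)) i) p)
          ≈⟨ R.*-assoc _ _ _ ⟨
        diag i ^ suc d *ᶠ E (loops (d * K + (K + l)) i) p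
          ≡⟨ cong (λ m → diag i ^ suc d *ᶠ E (loops m i) p) (trans (sym (ℕ.+-assoc (d * K) K l)) (cong (_+ l) (ℕ.+-comm (d * K) K))) ⟩
        diag i ^ suc d *ᶠ E (loops (suc d * K + l) i) p ∎
        where
        q : Poly F n
        q = fold p (row i) d

    private
      op : (Fin n → ℕ) → Fin n → Poly F n → Poly F n
      op g i q = con (recip! F (g i * K)) ⊗ fold q (row i) (g i)

    recip!0 : recip! F 0 ≈ 1#
    recip!0 = begin
      recip! F 0                      ≈⟨ R.*-identityʳ _ ⟨
      recip! F 0 *ᶠ 1#                ≈⟨ *-congˡ (R.+-identityʳ 1#) ⟨
      recip! F 0 *ᶠ fromℕ F 1         ≈⟨ recip-inverse F 1 ⟩
      1#                              ∎

    op-cong : ∀ g i {p q} → p ≃ q → op g i p ≃ op g i q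
    op-cong g i {p} {q} p≃q L = ≈-trans (E-scale L _ _)
      (≈-trans (*-congˡ (fold-row-cong i (g i) p≃q L)) (≈-sym (E-scale L _ _)))

    op-0 : ∀ g i p → g i ≡ 0 → op g i p ≃ p
    op-0 g i p gi≡0 L rewrite gi≡0 = ≈-trans (E-scale L _ p) (≈-trans (*-congʳ recip!0) (R.*-identityˡ _))

    ops : (Fin n → ℕ) → Poly F n → List (Fin n) → Poly F n
    ops g p = foldr (op g) p

    ops-none : ∀ g p is → (∀ {j} → j ∈ is → g j ≡ 0) → ops g p is ≃ p
    ops-none g p []       g≡0 L = ≈-refl
    ops-none g p (i ∷ is) g≡0 L = ≈-trans (op-0 g i _ (g≡0 (here refl)) L) (ops-none g p is (g≡0 ∘ there) L)

    ops-one : ∀ g p {is i} → Unique is → i ∈ is → (∀ {j} → j ∈ is → j ≢ i → g j ≡ 0) → ops g p is ≃ op g i p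
    ops-one g p (i≢ ∷ _) (here refl) g≡0 =
      op-cong g _ (ops-none g p _ λ j∈ → g≡0 (there j∈) (All.lookup i≢ j∈ ∘ sym))
    ops-one g p (x≢ ∷ uniq) (there i∈) g≡0 L =
      ≈-trans (op-0 g _ _ (g≡0 (here refl) (All.lookup x≢ i∈)) L) (ops-one g p uniq i∈ (g≡0 ∘ there) L)

    -- The factors act in the order of the list, so either of `a` and `b` may be the outer one.
    -- Keeping both outcomes avoids a proof that row operators commute; the vanishing shown later is
    -- symmetric in them.
    ops-two : ∀ g p {is a b} → Unique is → a ∈ is → b ∈ is → a ≢ b →
              (∀ {j} → j ∈ is → j ≢ a → j ≢ b → g j ≡ 0) →
              (ops g p is ≃ op g a (op g b p)) ⊎ (ops g p is ≃ op g b (op g a p))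
    ops-two g p (a≢ ∷ uniq) (here refl) (here refl) a≢b g≡0 = contradiction refl a≢b
    ops-two g p (a≢ ∷ uniq) (here refl) (there b∈) a≢b g≡0 = inj₁ (op-cong g _ (ops-one g p uniq b∈
      λ j∈ j≢b → g≡0 (there j∈) (All.lookup a≢ j∈ ∘ sym) j≢b))
    ops-two g p (b≢ ∷ uniq) (there a∈) (here refl) a≢b g≡0 = inj₂ (op-cong g _ (ops-one g p uniq a∈
      λ j∈ j≢a → g≡0 (there j∈) j≢a (All.lookup b≢ j∈ ∘ sym)))
    ops-two g p (x≢ ∷ uniq) (there a∈) (there b∈) a≢b g≡0
      with ops-two g p uniq a∈ b∈ a≢b (g≡0 ∘ there)
    ... | inj₁ eq = inj₁ λ L → ≈-trans (op-0 g _ _ gx≡0 L) (eq L)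
      where gx≡0 = g≡0 (here refl) (All.lookup x≢ a∈) (All.lookup x≢ b∈)
    ... | inj₂ eq = inj₂ λ L → ≈-trans (op-0 g _ _ gx≡0 L) (eq L)
      where gx≡0 = g≡0 (here refl) (All.lookup x≢ a∈) (All.lookup x≢ b∈)

    -- The complement of `i` is closed because no arc starts there: a walk that has left `i` cannot
    -- go on to a further arc.
    non-loop-zero : ∀ m i {L} → All (λ a → proj₁ a ≡ i) L → Any (λ a → proj₂ a ≢ i) L → E L (tracePower F n m) ≈ 0#
    non-loop-zero m i from-i leaves = trace-zero m
      (All.map (λ a≡i a≢i → contradiction a≡i a≢i) from-i) leaves (nonempty from-i leaves)
      where
      open ClosedSet (_≢ i) (λ x → ¬? (x Fin.≟ i))
      nonempty : ∀ {L} → All (λ a → proj₁ a ≡ i) L → Any (λ a → proj₂ a ≢ i) L → Any (λ a → ¬ (proj₁ a ≢ i)) L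
      nonempty (a≡i ∷ _) _ = here (λ a≢i → a≢i a≡i)

    traceOperator-concentrated : ∀ ds i d → lookup ds i ≡ suc d → (∀ j → j ≢ i → lookup ds j ≡ 0) → NonZero (suc d * K) →
      constantTerm F (traceOperator F {k} T ds (tracePower F n (suc d * K))) ≈ diag i ^ suc d
    traceOperator-concentrated ds i d dsᵢ≡d others nz = begin
      E [] (ops g p (allFin n))
        ≈⟨ ops-one g p (Unique.allFin⁺ n) (∈-allFin i) (λ {j} _ → others j) [] ⟩
      E [] (op g i p)
        ≡⟨ cong (λ e → E [] (con (recip! F (e * K)) ⊗ fold p (row i) e)) dsᵢ≡d ⟩
      recip! F m *ᶠ E [] (fold p (row i) (suc d))
        ≈⟨ *-congˡ (E-fold-row i p (non-loop-zero m i) (suc d) 0) ⟩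
      recip! F m *ᶠ (diag i ^ suc d *ᶠ E (loops (m + 0) i) p)
        ≡⟨ cong (λ e → recip! F m *ᶠ (diag i ^ suc d *ᶠ E (loops e i) p)) (ℕ.+-identityʳ m) ⟩
      recip! F m *ᶠ (diag i ^ suc d *ᶠ E (loops m i) p)
        -- The m! orders in which the closed walk can run through the m loops cancel the prefactor
        -- 1/m!.
        ≈⟨ *-congˡ (*-congˡ (E-loops-trace m {{nz}} i)) ⟩
      recip! F m *ᶠ (diag i ^ suc d *ᶠ fromℕ F (m !))
        ≈⟨ *-congˡ (R.*-comm _ _) ⟩
      recip! F m *ᶠ (fromℕ F (m !) *ᶠ diag i ^ suc d)
        ≈⟨ R.*-assoc _ _ _ ⟨
      (recip! F m *ᶠ fromℕ F (m !)) *ᶠ diag i ^ suc d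
        ≈⟨ *-congʳ (recip-inverse F (m !) {{m !≢0}}) ⟩
      1# *ᶠ diag i ^ suc d
        ≈⟨ R.*-identityˡ _ ⟩
      diag i ^ suc d ∎
      where
      m : ℕ
      m = suc d * K
      g : Fin n → ℕ
      g = lookup ds
      p : Poly F n
      p = tracePower F n m

    -- Satisfied by tensors of hypergraphs all of whose edges have at least three vertices.
    NoPairEdges : Set ℓ₁
    NoPairEdges = ∀ a b γ → VecAll.All (λ j → j ≡ a ⊎ j ≡ b) γ → γ ≢ Vec.replicate K a → T a γ ≈ 0#

    module _ (K≢0 : NonZero K) (sparse : NoPairEdges) where

      private
        nonZero : ∀ d → NonZero (suc d * K)
        nonZero d = ℕ.m*n≢0 (suc d) K {{_}} {{K≢0}}

      -- The outer row acts first on the list, so its index `γ` is fixed before the index `δ` of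
      -- `row b`. Three cases for `γ` suffice, whatever `δ` is.
      two-rows-zero : ∀ m a b → a ≢ b → E [] (row a (row b (tracePower F n m))) ≈ 0#
      two-rows-zero m a b a≢b = row-zero [] a _ first
        where
        in-pair? : Decidable (λ j → j ≡ a ⊎ j ≡ b)
        in-pair? j = (j Fin.≟ a) ⊎-dec (j Fin.≟ b)

        first : ∀ γ → E (pushArcs a γ []) (row b (tracePower F n m)) ≈ 0# ⊎ T a γ ≈ 0#
        first γ with VecAll.all? (Fin._≟ a) γ
        -- All arcs from `a` are loops, so `a` alone is a closed set, and the arcs from `b` start
        -- outside it.
        ... | yes γ≡a = inj₁ (row-zero _ b _ λ δ → inj₁ (trace-zero m
                (pushArcs-all-targets _ b δ (λ _ b≡a → contradiction (sym b≡a) a≢b)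
                  (pushArcs-all (VecAll.map (λ j≡a _ → j≡a) γ≡a) []))
                (pushArcs-any-old δ (pushArcs-any-new (All⇒Any γ≡a K≢0)))
                (pushArcs-any-new (All⇒Any (VecAll.universal (λ _ → a≢b ∘ sym) δ) K≢0))))
          where
          open ClosedSet (_≡ a) (Fin._≟ a)
        ... | no γ≢a with VecAll.all? in-pair? γ
        -- The arcs might form a closed walk inside the pair here; it is the tensor entry that
        -- vanishes.
        ...   | yes in-pair = inj₂ (sparse a b γ in-pair λ γ≡ → γ≢a (subst (VecAll.All (_≡ a)) (sym γ≡) (all-replicate K a)))
        -- Some arc leaves the pair. The complement of the pair is closed since no arc starts in it.
        ...   | no ¬in-pair = inj₁ (row-zero _ b _ λ δ → inj₁ (trace-zero m
                (pushArcs-all-targets _ b δ (λ _ b-out → contradiction (inj₂ refl) b-out)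
                  (pushArcs-all-targets _ a γ (λ _ a-out → contradiction (inj₁ refl) a-out) []))
                (pushArcs-any-old δ (pushArcs-any-new (¬All⇒Any¬ in-pair? γ ¬in-pair)))
                (pushArcs-any-new (All⇒Any (VecAll.universal (λ _ b-out → b-out (inj₂ refl)) δ) K≢0))))
          where open ClosedSet (λ j → ¬ (j ≡ a ⊎ j ≡ b)) (λ j → ¬? (in-pair? j))

      two-ops-zero : ∀ m g a b → a ≢ b → g a ≡ 1 → g b ≡ 1 → E [] (op g a (op g b (tracePower F n m))) ≈ 0#
      two-ops-zero m g a b a≢b ga≡1 gb≡1 rewrite ga≡1 | gb≡1 =
        ≈-trans (*-congˡ (≈-trans (row-scale a _ _ []) (≈-trans (*-congˡ (two-rows-zero m a b a≢b)) (R.zeroʳ _)))) (R.zeroʳ _)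

      traceOperator-mixed : ∀ m ds a b → Mixed ds a b → constantTerm F (traceOperator F {k} T ds (tracePower F n m)) ≈ 0#
      traceOperator-mixed m ds a b (a≢b , dsa , dsb , others)
        with ops-two (lookup ds) (tracePower F n m) (Unique.allFin⁺ n) (∈-allFin a) (∈-allFin b) a≢b (λ {j} _ → others j)
      ... | inj₁ eq = ≈-trans (eq []) (two-ops-zero m (lookup ds) a b a≢b dsa dsb)
      ... | inj₂ eq = ≈-trans (eq []) (two-ops-zero m (lookup ds) b a (a≢b ∘ sym) dsb dsa)

      Tr-1 : Tr F {k} 1 T ≈ fromℕ F (K ℕ^ (n ∸ 1)) *ᶠ Σᶠ (allFin n) diag
      Tr-1 = *-congˡ (begin
        constantTerm F (Σᴾ F (weakCompositions F n 1) (λ ds → traceOperator F {k} T ds p))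
          ≡⟨ E-Σ [] (weakCompositions F n 1) _ ⟩
        Σᶠ (weakCompositions F n 1) (λ ds → constantTerm F (traceOperator F {k} T ds p))
          ≈⟨ Σᶠ-weakCompositions-1 n _ ⟩
        Σᶠ (allFin n) (λ i → constantTerm F (traceOperator F {k} T (single i 1) p))
          ≈⟨ Σᶠ-cong (allFin n) (λ i → traceOperator-concentrated (single i 1) i 0 (lookup-single i 1) (lookup-single-≢ i 1) (nonZero 0)) ⟩
        Σᶠ (allFin n) (λ i → diag i ^ 1)
          ≈⟨ Σᶠ-cong (allFin n) (λ i → R.*-identityʳ _) ⟩
        Σᶠ (allFin n) diag ∎)
        where
        p : Poly F n
        p = tracePower F n (1 * K)

      Tr-2 : Tr F {k} 2 T ≈ fromℕ F (K ℕ^ (n ∸ 1)) *ᶠ Σᶠ (allFin n) (λ i → diag i *ᶠ diag i)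
      Tr-2 = *-congˡ (begin
        constantTerm F (Σᴾ F (weakCompositions F n 2) (λ ds → traceOperator F {k} T ds p))
          ≡⟨ E-Σ [] (weakCompositions F n 2) _ ⟩
        Σᶠ (weakCompositions F n 2) (λ ds → constantTerm F (traceOperator F {k} T ds p))
          ≈⟨ Σᶠ-weakCompositions-2 n _ (traceOperator-mixed (2 * K)) ⟩
        Σᶠ (allFin n) (λ i → constantTerm F (traceOperator F {k} T (single i 2) p))
          ≈⟨ Σᶠ-cong (allFin n) (λ i → traceOperator-concentrated (single i 2) i 1 (lookup-single i 2) (lookup-single-≢ i 2) (nonZero 1)) ⟩
        Σᶠ (allFin n) (λ i → diag i ^ 2)
          ≈⟨ Σᶠ-cong (allFin n) (λ i → *-congˡ (R.*-identityʳ _)) ⟩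
        Σᶠ (allFin n) (λ i → diag i *ᶠ diag i) ∎)
        where
        p : Poly F n
        p = tracePower F n (2 * K)

  -- Traces of the α-tensor in terms of degrees

  Σᶠ-fromℕ : ∀ n (f : Fin n → ℕ) → Σᶠ (allFin n) (λ i → fromℕ F (f i)) ≈ fromℕ F (sum f)
  Σᶠ-fromℕ zero    f = ≈-refl
  Σᶠ-fromℕ (suc n) f = begin
    Σᶠ (allFin (suc n)) (λ i → fromℕ F (f i))                      ≡⟨ Σᶠ-allFin-suc n _ ⟩
    fromℕ F (f zero) +ᶠ Σᶠ (allFin n) (λ i → fromℕ F (f (suc i)))  ≈⟨ +-congˡ (Σᶠ-fromℕ n (f ∘ suc)) ⟩
    fromℕ F (f zero) +ᶠ fromℕ F (sum (f ∘ suc))                    ≈⟨ fromℕ-+ (f zero) _ ⟨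
    fromℕ F (sum f)                                                ∎

  *-fromℕ-mono-< : ∀ {x a b} → 0# <ᶠ x → a < b → x *ᶠ fromℕ F a <ᶠ x *ᶠ fromℕ F b
  *-fromℕ-mono-< {x} {a} 0<x a<b with ℕ.m≤n⇒∃[o]m+o≡n a<b
  ... | o , refl = SPO.<-respˡ-≈ (R.+-identityʳ _) (SPO.<-respʳ-≈ split (+-monoʳ-< (x *ᶠ fromℕ F a) (*-pos 0<x (fromℕ-pos F o))))
    where
    module SPO = IsStrictPartialOrder isStrictPartialOrder
    split : x *ᶠ fromℕ F a +ᶠ x *ᶠ fromℕ F (suc o) ≈ x *ᶠ fromℕ F (suc a + o)
    split = begin
      x *ᶠ fromℕ F a +ᶠ x *ᶠ fromℕ F (suc o)  ≈⟨ R.distribˡ x _ _ ⟨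
      x *ᶠ (fromℕ F a +ᶠ fromℕ F (suc o))     ≈⟨ *-congˡ (fromℕ-+ a (suc o)) ⟨
      x *ᶠ fromℕ F (a + suc o)                ≡⟨ cong (λ e → x *ᶠ fromℕ F e) (ℕ.+-suc a o) ⟩
      x *ᶠ fromℕ F (suc a + o)                ∎

  indexSet-all : ∀ {n m} {P : Fin n → Set} {v : Vec (Fin n) m} {x} → VecAll.All P v → x ∈ˢ indexSet F v → P x
  indexSet-all VecAll.[] x∈ = contradiction x∈ ∉⊥
  indexSet-all {P = P} {v = y ∷ v} (py VecAll.∷ pv) x∈ with x∈p∪q⁻ ⁅ y ⁆ (indexSet F v) x∈
  ... | inj₁ x∈y = subst P (sym (x∈⁅y⁆⇒x≡y y x∈y)) py
  ... | inj₂ x∈v = indexSet-all pv x∈v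

  module _ (k : ℕ) (K≢0 : NonZero (k ∸ 1)) {n : ℕ} (α : Carrier) (H : Hypergraph n)
           (three : ∀ {e} → e ∈ edges H → ThreeVertices e) where

    private
      T : Tensor F k n
      T = alphaTensor F k α H

      C : Carrier
      C = fromℕ F ((k ∸ 1) ℕ^ (n ∸ 1))

    open DecMembership (_≟ˢ_ {n}) using (_∈?_)

    -- An edge has a vertex different from both `a` and `b`, so it is not the index set of such an
    -- entry.
    adjacencyTensor-pair : ∀ a b γ → VecAll.All (λ j → j ≡ a ⊎ j ≡ b) γ → adjacencyTensor F k H a γ ≈ 0#
    adjacencyTensor-pair a b γ in-pair =
      R.reflexive (cong (if_then recip! F (k ∸ 1) else 0#) (dec-false (indexSet F (a ∷ γ) ∈? edges H) not-edge))
      where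
      not-edge : ¬ indexSet F (a ∷ γ) ∈ edges H
      not-edge e∈ with threeVertices-avoid (three e∈) a b
      ... | v , v∈ , v≢a , v≢b with indexSet-all (inj₁ refl VecAll.∷ in-pair) v∈
      ...   | inj₁ v≡a = v≢a v≡a
      ...   | inj₂ v≡b = v≢b v≡b

    alphaTensor-sparse : NoPairEdges {k} T
    alphaTensor-sparse a b γ in-pair γ≢
      rewrite dec-false (≡-dec Fin._≟_ γ (Vec.replicate (k ∸ 1) a)) γ≢ =
      ≈-trans (+-cong (R.zeroʳ α) (≈-trans (*-congˡ (adjacencyTensor-pair a b γ in-pair)) (R.zeroʳ _))) (R.+-identityʳ 0#)

    alphaTensor-diagonal : ∀ i → T i (Vec.replicate (k ∸ 1) i) ≈ α *ᶠ fromℕ F (degree H i)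
    alphaTensor-diagonal i
      rewrite dec-true (≡-dec Fin._≟_ (Vec.replicate (k ∸ 1) i) (Vec.replicate (k ∸ 1) i)) refl =
      -- The degenerate pair with both members equal to `i` shows that adjacency does not contribute
      -- to the diagonal.
      ≈-trans (+-congˡ (≈-trans (*-congˡ (adjacencyTensor-pair i i _ (VecAll.map inj₁ (all-replicate (k ∸ 1) i)))) (R.zeroʳ _)))
              (R.+-identityʳ _)

    Tr-1-alphaTensor : Tr F {k} 1 T ≈ C *ᶠ (α *ᶠ fromℕ F (sum (degree H)))
    Tr-1-alphaTensor = ≈-trans (Tr-1 {k} T K≢0 alphaTensor-sparse) (*-congˡ (begin
      Σᶠ (allFin n) (λ i → T i (Vec.replicate (k ∸ 1) i))  ≈⟨ Σᶠ-cong (allFin n) alphaTensor-diagonal ⟩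
      Σᶠ (allFin n) (λ i → α *ᶠ fromℕ F (degree H i))      ≈⟨ Σᶠ-distribˡ α (allFin n) _ ⟩
      α *ᶠ Σᶠ (allFin n) (λ i → fromℕ F (degree H i))      ≈⟨ *-congˡ (Σᶠ-fromℕ n (degree H)) ⟩
      α *ᶠ fromℕ F (sum (degree H))                        ∎))

    Tr-2-alphaTensor : Tr F {k} 2 T ≈ (C *ᶠ (α *ᶠ α)) *ᶠ fromℕ F (sum (λ i → degree H i * degree H i))
    Tr-2-alphaTensor = ≈-trans (Tr-2 {k} T K≢0 alphaTensor-sparse) (≈-trans (*-congˡ (begin
      Σᶠ (allFin n) (λ i → T i (Vec.replicate (k ∸ 1) i) *ᶠ T i (Vec.replicate (k ∸ 1) i))
        ≈⟨ Σᶠ-cong (allFin n) square ⟩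
      Σᶠ (allFin n) (λ i → (α *ᶠ α) *ᶠ fromℕ F (degree H i * degree H i))
        ≈⟨ Σᶠ-distribˡ (α *ᶠ α) (allFin n) _ ⟩
      (α *ᶠ α) *ᶠ Σᶠ (allFin n) (λ i → fromℕ F (degree H i * degree H i))
        ≈⟨ *-congˡ (Σᶠ-fromℕ n _) ⟩
      (α *ᶠ α) *ᶠ fromℕ F (sum (λ i → degree H i * degree H i)) ∎)) (≈-sym (R.*-assoc _ _ _)))
      where
      square : ∀ i → T i (Vec.replicate (k ∸ 1) i) *ᶠ T i (Vec.replicate (k ∸ 1) i) ≈ (α *ᶠ α) *ᶠ fromℕ F (degree H i * degree H i)
      square i = begin
        T i (Vec.replicate (k ∸ 1) i) *ᶠ T i (Vec.replicate (k ∸ 1) i)  ≈⟨ *-cong (alphaTensor-diagonal i) (alphaTensor-diagonal i) ⟩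
        (α *ᶠ fromℕ F d) *ᶠ (α *ᶠ fromℕ F d)                            ≈⟨ interchange α (fromℕ F d) α (fromℕ F d) ⟩
        (α *ᶠ α) *ᶠ (fromℕ F d *ᶠ fromℕ F d)                            ≈⟨ *-congˡ (fromℕ-* d d) ⟨
        (α *ᶠ α) *ᶠ fromℕ F (d * d)                                     ∎
        where
        open CommutativeSemigroupProperties R.*-commutativeSemigroup using (interchange)
        d : ℕ
        d = degree H i

  S-order-degrees : ∀ k {n} α (G H : Hypergraph n) → NonZero (k ∸ 1) → 0# <ᶠ α → 3 ≤ n →
    (∀ {e} → e ∈ edges G → ThreeVertices e) → (∀ {e} → e ∈ edges H → ThreeVertices e) →
    sum (degree G) ≡ sum (degree H) →
    sum (λ i → degree G i * degree G i) < sum (λ i → degree H i * degree H i) →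
    S-order F k α G H
  S-order-degrees k {n} α G H K≢0 0<α 3≤n three-G three-H deg≡ deg²< =
    2 , s≤s z≤n , 2≤bound , agree ,
    SPO.<-respˡ-≈ (≈-sym (Tr-2-alphaTensor k K≢0 α G three-G))
      (SPO.<-respʳ-≈ (≈-sym (Tr-2-alphaTensor k K≢0 α H three-H))
        (*-fromℕ-mono-< (*-pos (fromℕ-pos′ X) (*-pos 0<α 0<α)) deg²<))
    where
    module SPO = IsStrictPartialOrder isStrictPartialOrder

    X : ℕ
    X = (k ∸ 1) ℕ^ (n ∸ 1)

    instance
      X≢0 : NonZero X
      X≢0 = ℕ.m^n≢0 (k ∸ 1) (n ∸ 1) {{K≢0}}

    fromℕ-pos′ : ∀ m .{{_ : NonZero m}} → 0# <ᶠ fromℕ F m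
    fromℕ-pos′ (suc m) = fromℕ-pos F m

    -- The order only admits d below the number of eigenvalues; three vertices and `X ≥ 1` leave
    -- room for d = 2.
    2≤bound : 2 ≤ n * X ∸ 1
    2≤bound = ℕ.∸-monoˡ-≤ 1 (ℕ.≤-trans 3≤n (ℕ.m≤m*n n X))

    agree : ∀ t → t < 2 → Tr F {k} t (alphaTensor F k α G) ≈ Tr F {k} t (alphaTensor F k α H)
    -- The zeroth trace depends on `n` and `k` only.
    agree 0 _ = ≈-refl
    agree 1 _ = begin
      Tr F {k} 1 (alphaTensor F k α G)                ≈⟨ Tr-1-alphaTensor k K≢0 α G three-G ⟩
      fromℕ F X *ᶠ (α *ᶠ fromℕ F (sum (degree G)))    ≡⟨ cong (λ s → fromℕ F X *ᶠ (α *ᶠ fromℕ F s)) deg≡ ⟩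
      fromℕ F X *ᶠ (α *ᶠ fromℕ F (sum (degree H)))    ≈⟨ Tr-1-alphaTensor k K≢0 α H three-H ⟨
      Tr F {k} 1 (alphaTensor F k α H)                ∎
    agree (suc (suc _)) (s≤s (s≤s ()))

-- Degrees in a coalescence

Injective : ∀ {m n} → (Fin m → Fin n) → Set
Injective f = ∀ {u v} → f u ≡ f v → u ≡ v

∈-image⁺ : ∀ {m n} (f : Fin m → Fin n) {e u} → u ∈ˢ e → f u ∈ˢ image f e
∈-image⁺ f {e} {u} u∈e = lookup⇒[]= (f u) (image f e)
  (trans (lookup∘tabulate _ (f u)) (dec-true (any? λ v → (v ∈ˢ? e) ×-dec (f v Fin.≟ f u)) (u , u∈e , refl)))

does-true : ∀ {a} {A : Set a} (a? : Dec A) → does a? ≡ true → A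
does-true (yes a) _ = a

∈-image⁻ : ∀ {m n} (f : Fin m → Fin n) {e v} → v ∈ˢ image f e → ∃[ u ] (u ∈ˢ e × f u ≡ v)
∈-image⁻ f {e} {v} v∈ = does-true (any? λ u → (u ∈ˢ? e) ×-dec (f u Fin.≟ v))
  (trans (sym (lookup∘tabulate _ v)) ([]=⇒lookup v∈))

∈-image-injective : ∀ {m n} {f : Fin m → Fin n} → Injective f → ∀ {e u} → f u ∈ˢ image f e → u ∈ˢ e
∈-image-injective {f = f} inj fu∈ with ∈-image⁻ f fu∈
... | u′ , u′∈e , eq = subst (_∈ˢ _) (inj eq) u′∈e

image-injective : ∀ {m n} {f : Fin m → Fin n} → Injective f → ∀ {e e′} → image f e ≡ image f e′ → e ≡ e′
image-injective {f = f} inj eq = ⊆-antisym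
  (λ u∈ → ∈-image-injective inj (subst (f _ ∈ˢ_) eq (∈-image⁺ f u∈)))
  (λ u∈ → ∈-image-injective inj (subst (f _ ∈ˢ_) (sym eq) (∈-image⁺ f u∈)))

ThreeVertices-image : ∀ {m n} {f : Fin m → Fin n} → Injective f → ∀ {e} → ThreeVertices e → ThreeVertices (image f e)
ThreeVertices-image {f = f} inj (p , q , r , p∈ , q∈ , r∈ , p≢q , p≢r , q≢r) =
  f p , f q , f r , ∈-image⁺ f p∈ , ∈-image⁺ f q∈ , ∈-image⁺ f r∈ , p≢q ∘ inj , p≢r ∘ inj , q≢r ∘ inj

-- Returning the rest as a subset that avoids `x` lets repeated extraction produce pairwise distinct
-- vertices.
extract-vertex : ∀ {n c} (e : Subset n) → suc c ≤ ∣ e ∣ → ∃[ x ] ∃[ e′ ] (x ∈ˢ e × ¬ x ∈ˢ e′ × e′ ⊆ e × c ≤ ∣ e′ ∣)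
extract-vertex (true ∷ e) (s≤s c≤) = zero , false ∷ e , here , (λ ()) , out⊆ ⊆-refl , c≤
extract-vertex (false ∷ e) c<
  with x , e′ , x∈ , x∉ , e′⊆ , c≤ ← extract-vertex e c<
  = suc x , false ∷ e′ , there x∈ , x∉ ∘ drop-there , s⊆s e′⊆ , c≤

three≤∣e∣⇒ThreeVertices : ∀ {n} (e : Subset n) → 3 ≤ ∣ e ∣ → ThreeVertices e
three≤∣e∣⇒ThreeVertices e 3≤
  with p , e₁ , p∈ , p∉ , e₁⊆ , 2≤ ← extract-vertex e 3≤
  with q , e₂ , q∈ , q∉ , e₂⊆ , 1≤ ← extract-vertex e₁ 2≤
  with r , e₃ , r∈ , _ , _ , _ ← extract-vertex e₂ 1≤
  = p , q , r , p∈ , e₁⊆ q∈ , e₁⊆ (e₂⊆ r∈) ,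
    (λ { refl → p∉ q∈ }) , (λ { refl → p∉ (e₂⊆ r∈) }) , (λ { refl → q∉ r∈ })

count : ∀ {n} → Fin n → List (Subset n) → ℕ
count v es = length (filter (v ∈ˢ?_) es)

count-++ : ∀ {n} (v : Fin n) es es′ → count v (es ++ es′) ≡ count v es + count v es′
count-++ v es es′ = trans (cong length (filter-++ (v ∈ˢ?_) es es′)) (length-++ (filter (v ∈ˢ?_) es))

count-image : ∀ {m n} {f : Fin m → Fin n} → Injective f → ∀ u es → count (f u) (map (image f) es) ≡ count u es
count-image inj u [] = refl
count-image {f = f} inj u (e ∷ es) with f u ∈ˢ? image f e | u ∈ˢ? e
... | yes _   | yes _   = cong suc (count-image inj u es)
... | no _    | no _    = count-image inj u es
... | yes fu∈ | no u∉   = contradiction (∈-image-injective inj fu∈) u∉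
... | no fu∉  | yes u∈  = contradiction (∈-image⁺ f u∈) fu∉

count-outside-image : ∀ {m n} {f : Fin m → Fin n} {v} → (∀ u → f u ≢ v) → ∀ es → count v (map (image f) es) ≡ 0
count-outside-image {f = f} {v} outside es = cong length (filter-none (v ∈ˢ?_)
  (All.map⁺ (All.universal (λ e v∈ → let u , _ , fu≡v = ∈-image⁻ f v∈ in outside u fu≡v) es)))

-- Lets the degrees in a coalescence be counted separately in the two lists of image edges.
deduplicate-unique : ∀ {n} {es : List (Subset n)} → Unique es → deduplicate _≟ˢ_ es ≡ es
deduplicate-unique [] = refl
deduplicate-unique {es = e ∷ es} (e≢ ∷ uniq) =
  cong (e ∷_) (trans (cong (filter _) (deduplicate-unique uniq)) (filter-all _ e≢))

↑ˡ≢↑ʳ : ∀ {m n} (i : Fin m) (j : Fin n) → i ↑ˡ n ≢ m ↑ʳ j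
↑ˡ≢↑ʳ {m} {n} i j eq with trans (sym (splitAt-↑ˡ m i n)) (trans (cong (splitAt m) eq) (splitAt-↑ʳ m n j))
... | ()

module _ {m n : ℕ} (x : Fin m) (y : Fin (suc n)) where

  glue-self : glue x y y ≡ x ↑ˡ n
  glue-self with y Fin.≟ y
  ... | yes _  = refl
  ... | no y≢y = contradiction refl y≢y

  glue-punchIn : ∀ j → glue x y (punchIn y j) ≡ m ↑ʳ j
  glue-punchIn j with y Fin.≟ punchIn y j
  ... | yes y≡ = contradiction (sym y≡) (punchInᵢ≢i y j)
  ... | no _   = cong (m ↑ʳ_) (trans (punchOut-cong y refl) (punchOut-punchIn y))

  -- Only `y` is sent into the first block of vertices, and it is sent to `x`.
  glue-old : ∀ {v z} → glue x y v ≡ z ↑ˡ n → x ≡ z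
  glue-old {v} eq with y Fin.≟ v
  ... | yes _ = ↑ˡ-injective n _ _ eq
  ... | no _  = contradiction (sym eq) (↑ˡ≢↑ʳ _ _)

  glue-injective : Injective (glue x y)
  glue-injective {u} {v} eq with y Fin.≟ u | y Fin.≟ v
  ... | yes refl | yes refl = refl
  ... | yes _    | no _     = contradiction eq (↑ˡ≢↑ʳ _ _)
  ... | no _     | yes _    = contradiction (sym eq) (↑ˡ≢↑ʳ _ _)
  ... | no y≢u   | no y≢v   = punchOut-injective y≢u y≢v (↑ʳ-injective m _ _ eq)

-- Sums over the vertices of a coalescence

bump : ∀ {m} → Fin m → ℕ → Fin m → ℕ
bump x D v = if does (x Fin.≟ v) then D else 0

-- Only the summand at `x` changes, by `c`. The summand is a general `h` so that degrees and their
-- squares are handled alike.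
sum-bump : ∀ {m} (h : Fin m → ℕ → ℕ) x {D c} → h x D ≡ h x 0 + c →
           sum (λ v → h v (bump x D v)) ≡ sum (λ v → h v 0) + c
sum-bump h zero    {D} {c} eq = trans (cong (_+ sum (λ v → h (suc v) 0)) eq) (xy∙z≈xz∙y (h zero 0) c _)
  where open CommutativeSemigroupProperties ℕ.+-commutativeSemigroup using (xy∙z≈xz∙y)
sum-bump h (suc x) {D} {c} eq = trans (cong (h zero 0 +_) (sum-bump (h ∘ suc) x eq)) (sym (ℕ.+-assoc (h zero 0) _ c))

sum-splitAt : ∀ m {n} (f : Fin (m + n) → ℕ) → sum f ≡ sum (f ∘ (_↑ˡ n)) + sum (f ∘ (m ↑ʳ_))
sum-splitAt zero    f = refl
sum-splitAt (suc m) f = trans (cong (f zero +_) (sum-splitAt m (f ∘ suc))) (sym (ℕ.+-assoc (f zero) _ _))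

module _ {m n : ℕ} (G : Hypergraph m) (H : Hypergraph (suc n)) (y : Fin (suc n))
         (three-G : ∀ {e} → e ∈ edges G → ThreeVertices e)
         (three-H : ∀ {e} → e ∈ edges H → ThreeVertices e) where

  module _ (x : Fin m) where

    private
      united : List (Subset (m + n))
      united = map (image (_↑ˡ n)) (edges G) ++ map (image (glue x y)) (edges H)

      ↑ˡ-inj : Injective {m} (_↑ˡ n)
      ↑ˡ-inj = ↑ˡ-injective n _ _

    -- An edge of G has a vertex other than x, which no edge of H contains.
    united-unique : Unique united
    united-unique = Unique.++⁺
      (Unique.map⁺ (image-injective ↑ˡ-inj) (unique G))
      (Unique.map⁺ (image-injective (glue-injective x y)) (unique H))
      disjoint
      where
      disjoint : ∀ {e} → ¬ (e ∈ map (image (_↑ˡ n)) (edges G) × e ∈ map (image (glue x y)) (edges H))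
      disjoint (e∈G , e∈H)
        with g , g∈ , refl ← ∈-map⁻ _ e∈G
        with h , _ , eq ← ∈-map⁻ _ e∈H
        with v , v∈ , v≢x , _ ← threeVertices-avoid (three-G g∈) x x
        with _ , _ , glue≡v ← ∈-image⁻ (glue x y) (subst (v ↑ˡ n ∈ˢ_) eq (∈-image⁺ (_↑ˡ n) v∈))
        = v≢x (sym (glue-old x y glue≡v))

    private
      degree-united : ∀ v → degree (coalescence G x H y) v ≡
                      count v (map (image (_↑ˡ n)) (edges G)) + count v (map (image (glue x y)) (edges H))
      degree-united v = trans (cong (count v) (deduplicate-unique united-unique))
                              (count-++ v (map (image (_↑ˡ n)) (edges G)) _)

    degree-coalescence-↑ˡ : ∀ v → degree (coalescence G x H y) (v ↑ˡ n) ≡ degree G v + bump x (degree H y) v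
    degree-coalescence-↑ˡ v = trans (degree-united (v ↑ˡ n)) (cong₂ _+_ (count-image ↑ˡ-inj v (edges G)) glued)
      where
      glued : count (v ↑ˡ n) (map (image (glue x y)) (edges H)) ≡ bump x (degree H y) v
      glued with x Fin.≟ v
      ... | yes refl = trans (cong (λ z → count z (map (image (glue x y)) (edges H))) (sym (glue-self x y)))
                             (count-image (glue-injective x y) y (edges H))
      ... | no x≢v   = count-outside-image (λ u eq → x≢v (glue-old x y {u} eq)) (edges H)

    degree-coalescence-↑ʳ : ∀ j → degree (coalescence G x H y) (m ↑ʳ j) ≡ degree H (punchIn y j)
    degree-coalescence-↑ʳ j = trans (degree-united (m ↑ʳ j)) (cong₂ _+_
      (count-outside-image (λ u → ↑ˡ≢↑ʳ u j) (edges G))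
      (trans (cong (λ z → count z (map (image (glue x y)) (edges H))) (sym (glue-punchIn x y j)))
             (count-image (glue-injective x y) (punchIn y j) (edges H))))

    ThreeVertices-coalescence : ∀ {e} → e ∈ edges (coalescence G x H y) → ThreeVertices e
    ThreeVertices-coalescence {e} e∈ with ∈-++⁻ (map (image (_↑ˡ n)) (edges G)) (subst (e ∈_) (deduplicate-unique united-unique) e∈)
    ... | inj₁ e∈G with g , g∈ , refl ← ∈-map⁻ _ e∈G = ThreeVertices-image ↑ˡ-inj (three-G g∈)
    ... | inj₂ e∈H with h , h∈ , refl ← ∈-map⁻ _ e∈H = ThreeVertices-image (glue-injective x y) (three-H h∈)

    -- Isolates the dependence on `x` in the single term `c`. It is applied with the identity and
    -- with squaring; the `+ 0` is the value of `bump` away from `x`.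
    sum-degrees-coalescence : ∀ (φ : ℕ → ℕ) c → φ (degree G x + degree H y) ≡ φ (degree G x + 0) + c →
      sum (φ ∘ degree (coalescence G x H y)) ≡
      (sum (λ v → φ (degree G v + 0)) + c) + sum (λ j → φ (degree H (punchIn y j)))
    sum-degrees-coalescence φ c eq = trans (sum-splitAt m (φ ∘ degree (coalescence G x H y))) (cong₂ _+_
      (trans (sum-cong-≗ (cong φ ∘ degree-coalescence-↑ˡ)) (sum-bump (λ v b → φ (degree G v + b)) x eq))
      (sum-cong-≗ (cong φ ∘ degree-coalescence-↑ʳ)))

  sum-degrees-coalescence-const : ∀ u w → sum (degree (coalescence G w H y)) ≡ sum (degree (coalescence G u H y))
  sum-degrees-coalescence-const u w = trans (at w) (sym (at u))
    where
    at = λ x → sum-degrees-coalescence x (λ d → d) (degree H y) (cong (_+ degree H y) (sym (ℕ.+-identityʳ (degree G x))))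

  sum-squares-coalescence-< : ∀ {u w} → degree G w < degree G u → 1 ≤ degree H y →
    sum (λ i → degree (coalescence G w H y) i * degree (coalescence G w H y) i) <
    sum (λ i → degree (coalescence G u H y) i * degree (coalescence G u H y) i)
  sum-squares-coalescence-< {u} {w} w<u 1≤D = subst₂ _<_ (sym (at w)) (sym (at u))
    (ℕ.+-monoˡ-< (sum (λ j → degree H (punchIn y j) * degree H (punchIn y j))) (ℕ.+-monoʳ-< (sum (λ v → (degree G v + 0) * (degree G v + 0))) (ℕ.*-monoˡ-< D {{>-nonZero 1≤D}} (ℕ.+-monoˡ-< D (ℕ.+-mono-< w<u w<u)))))
    where
    D : ℕ
    D = degree H y
    -- The increment (2d + D)D of the square at the glued vertex is strictly increasing in d,
    -- because D ≥ 1.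
    expand : ∀ d D → (d + D) * (d + D) ≡ (d + 0) * (d + 0) + (d + d + D) * D
    expand = solve-∀
    at = λ x → sum-degrees-coalescence x (λ d → d * d) ((degree G x + degree G x + D) * D) (expand (degree G x) D)

-- Degrees and edges of the hyperpath

module _ (k : ℕ) (r : ℕ) where

  ∈-pathEdge : ∀ j {v s} → splitAt (suc r) v ≡ s → inPathEdge k {r} j s ≡ true → v ∈ˢ pathEdge k j
  ∈-pathEdge j {v} refl eq = lookup⇒[]= v (pathEdge k j) (trans (lookup∘tabulate (inPathEdge k j ∘ splitAt (suc r)) v) eq)

  private
    left-end : ∀ (j : Fin r) → inPathEdge k j (inj₁ (inject₁ j)) ≡ true
    left-end j = cong (_∨ does (inject₁ j Fin.≟ suc j)) (dec-true (inject₁ j Fin.≟ inject₁ j) refl)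

    right-end : ∀ (j : Fin r) → inPathEdge k j (inj₁ (suc j)) ≡ true
    right-end j = trans (cong (does (suc j Fin.≟ inject₁ j) ∨_) (dec-true (suc j Fin.≟ suc j) refl)) (∨-zeroʳ _)

  -- A path vertex `suc j` is the right end of edge `j`, an inserted vertex lies in the edge of its
  -- block, and the initial vertex lies in the first edge. The argument in `Fin r` witnesses that
  -- there is an edge.
  pathEdge-cover : Fin r → ∀ v → ∃[ j ] (v ∈ˢ pathEdge k j)
  pathEdge-cover j₀ v with splitAt (suc r) v in eq
  -- As `r` is a variable, the index of the first edge has to be computed from `j₀`.
  ... | inj₁ zero    = first j₀ , ∈-pathEdge (first j₀) eq (first-start j₀)
    where
    first : ∀ {r} → Fin r → Fin r
    first zero    = zero
    first (suc _) = zero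
    first-start : ∀ {r} (j : Fin r) → inPathEdge k (first j) (inj₁ zero) ≡ true
    first-start zero    = refl
    first-start (suc _) = refl
  ... | inj₁ (suc j) = j , ∈-pathEdge j eq (right-end j)
  ... | inj₂ c       = j , ∈-pathEdge j eq (dec-true (j Fin.≟ j) refl)
    where
    j : Fin r
    j = quotient (k ∸ 2) c

  -- Excludes degree 0, so that a non-cored vertex has degree at least 2.
  hyperpath-degree-pos : Fin r → ∀ v → 1 ≤ degree (hyperpath k r) v
  hyperpath-degree-pos j₀ v = let j , v∈ = pathEdge-cover j₀ v in
    filter-some (v ∈ˢ?_) (Any.map (λ { refl → v∈ }) (∈-map⁺ (pathEdge k) (∈-allFin j)))

  -- The two ends of the path edge and one inserted vertex; an element of `Fin (k ∸ 2)` exists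
  -- exactly when k ≥ 3.
  ThreeVertices-pathEdge : Fin (k ∸ 2) → ∀ (j : Fin r) → ThreeVertices (pathEdge k j)
  ThreeVertices-pathEdge c j =
    inject₁ j ↑ˡ _ , suc j ↑ˡ _ , suc r ↑ʳ combine j c ,
    ∈-pathEdge j (splitAt-↑ˡ (suc r) (inject₁ j) _) (left-end j) ,
    ∈-pathEdge j (splitAt-↑ˡ (suc r) (suc j) _) (right-end j) ,
    ∈-pathEdge j (splitAt-↑ʳ (suc r) _ (combine j c)) (dec-true (quotient (k ∸ 2) (combine j c) Fin.≟ j) (cong proj₁ (remQuot-combine j c))) ,
    (λ eq → ℕ.1+n≢n (sym (trans (sym (toℕ-inject₁ j)) (cong toℕ (↑ˡ-injective _ _ _ eq))))) ,
    ↑ˡ≢↑ʳ _ _ , ↑ˡ≢↑ʳ _ _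

  ThreeVertices-hyperpath : Fin (k ∸ 2) → ∀ {e} → e ∈ edges (hyperpath k r) → ThreeVertices e
  ThreeVertices-hyperpath c e∈ with j , _ , refl ← ∈-map⁻ (pathEdge k) e∈ = ThreeVertices-pathEdge c j

lemma4p2 : ∀ {c ℓ₁ ℓ₂} (F : OrderedField c ℓ₁ ℓ₂) → let open OrderedField F in
    (k : ℕ) → 3 ≤ k →
    (α : Carrier) → 0# <ᶠ α → α <ᶠ 1# →
    (r : ℕ) (u w : Fin (suc r + r * (k ∸ 2))) →
    ¬ Cored (hyperpath k r) u → Cored (hyperpath k r) w →
    (n : ℕ) (H₀ : Hypergraph (suc n)) → Uniform k H₀ →
    (v₀ : Fin (suc n)) → 1 ≤ degree H₀ v₀ →
    S-order F k α (coalescence (hyperpath k r) w H₀ v₀) (coalescence (hyperpath k r) u H₀ v₀)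
-- Without edges every degree is 0, so there is no cored vertex.
lemma4p2 F k 3≤k α 0<α α<1 zero u w ¬cored-u () n H₀ uniform v₀ 1≤deg
lemma4p2 F k@(suc (suc (suc k′))) 3≤k@(s≤s (s≤s (s≤s _))) α 0<α α<1 r@(suc r′) u w ¬cored-u cored-w n H₀ uniform v₀ 1≤deg =
  S-order-degrees F k α (coalescence P w H₀ v₀) (coalescence P u H₀ v₀) _ 0<α 3≤vertices
    (ThreeVertices-coalescence P H₀ v₀ three-P three-H₀ w) (ThreeVertices-coalescence P H₀ v₀ three-P three-H₀ u)
    (sum-degrees-coalescence-const P H₀ v₀ three-P three-H₀ u w)
    (sum-squares-coalescence-< P H₀ v₀ three-P three-H₀ degrees< 1≤deg)
  where
  P : Hypergraph (suc r + r * (k ∸ 2))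
  P = hyperpath k r

  three-P : ∀ {e} → e ∈ edges P → ThreeVertices e
  three-P = ThreeVertices-hyperpath k r zero

  three-H₀ : ∀ {e} → e ∈ edges H₀ → ThreeVertices e
  three-H₀ {e} e∈ = three≤∣e∣⇒ThreeVertices e (subst (3 ≤_) (sym (uniform e∈)) 3≤k)

  degrees< : degree P w < degree P u
  degrees< = subst (_< degree P u) (sym cored-w) (ℕ.≤∧≢⇒< (hyperpath-degree-pos k r zero u) (¬cored-u ∘ sym))

  3≤vertices : 3 ≤ suc r + r * (k ∸ 2) + n
  -- Two path vertices and one inserted vertex, since r ≥ 1 and k ≥ 3.
  3≤vertices = ℕ.≤-trans (s≤s (s≤s (ℕ.≤-trans (s≤s z≤n) (ℕ.m≤n+m (r * (k ∸ 2)) r′)))) (ℕ.m≤m+n _ n)
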